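{- Let $G$ be a graph of order $n$ with maximum degree $\Delta(G)=2$. Then $\mathcal{A}(G)\ge \mathcal{A}\big(K_{1,2}\cup(n-3)K_1\big)$, with equality if and only if $G\simeq K_{1,2}\cup (n-3)K_1$.
   Context: All graphs are finite, simple and undirected. A coloring of a graph $G$ assigns colors to its vertices so that adjacent vertices receive different colors; two colorings are equivalent if they induce the same partition of the vertex set into color classes. $S(G,k)$ denotes the number of non-equivalent colorings of $G$ using exactly $k$ colors. Set $\mathcal{B}(G)=\sum_{k\ge1}S(G,k)$, $\mathcal{T}(G)=\sum_{k\ge1}kS(G,k)$ and $\mathcal{A}(G)=\mathcal{T}(G)/\mathcal{B}(G)$. $K_{1,2}$ is the star with two leaves (path on 3 vertices), $\cup$ disjoint union, and $pK_1$ denotes $p$ isolated vertices. -}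

module Defs where

open import Data.Bool using (Bool; true; false; _∧_; _∨_; not; if_then_else_; T?; _xor_)
open import Data.Nat using (ℕ; zero; suc; _+_; _*_; _⊔_; _≡ᵇ_)
open import Data.Fin using (Fin; toℕ) renaming (zero to fzero; suc to fsuc)
open import Data.Fin.Properties using () renaming (_≟_ to _≟ᶠ_)
open import Data.List using (List; []; _∷_; map; concatMap; filter; length; foldr; allFin; deduplicateᵇ)
open import Data.Bool.ListAction using (all; any)
open import Data.Integer using (+_)
open import Data.Rational using (ℚ; _/_; 0ℚ)
open import Relation.Nullary.Decidable using (⌊_⌋)
open import Relation.Binary.PropositionalEquality using (_≡_; refl)
open import Data.Bool.Properties using (∨-comm)
open import Function.Bundles using (_↔_; Inverse)

record Graph (n : ℕ) : Set where
  field
    adj   : Fin n → Fin n → Bool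
    sym   : ∀ i j → adj i j ≡ adj j i
    irref : ∀ i → adj i i ≡ false
open Graph public

degree : ∀ {n} → Graph n → Fin n → ℕ
degree G i = length (filter (λ j → Data.Bool.T? (adj G i j)) (allFin _))
  where import Data.Bool

maxDegree : ∀ {n} → Graph n → ℕ
maxDegree G = foldr _⊔_ 0 (map (degree G) (allFin _))

_≃_ : ∀ {n} → Graph n → Graph n → Set
_≃_ {n} G H = Σ (Fin n ↔ Fin n) λ σ →
  ∀ i j → adj G i j ≡ adj H (Inverse.to σ i) (Inverse.to σ j)
  where open import Data.Product using (Σ)

edge01-02 : ℕ → ℕ → Bool
edge01-02 0 1 = true
edge01-02 0 2 = true
edge01-02 _ _ = false

isEdgeℕ : ℕ → ℕ → Bool
isEdgeℕ a b = edge01-02 a b ∨ edge01-02 b a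

isEdgeℕ-sym : ∀ a b → isEdgeℕ a b ≡ isEdgeℕ b a
isEdgeℕ-sym a b = ∨-comm (edge01-02 a b) (edge01-02 b a)

isEdgeℕ-irr : ∀ a → isEdgeℕ a a ≡ false
isEdgeℕ-irr 0 = refl
isEdgeℕ-irr 1 = refl
isEdgeℕ-irr 2 = refl
isEdgeℕ-irr (suc (suc (suc a))) = refl

K12∪K1s : (n : ℕ) → Graph n
K12∪K1s n = record
  { adj   = λ i j → isEdgeℕ (toℕ i) (toℕ j)
  ; sym   = λ i j → isEdgeℕ-sym (toℕ i) (toℕ j)
  ; irref = λ i → isEdgeℕ-irr (toℕ i) }

_∷ᶠ_ : ∀ {n k} → Fin k → (Fin n → Fin k) → Fin (suc n) → Fin k
(a ∷ᶠ f) fzero    = a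
(a ∷ᶠ f) (fsuc i) = f i

allMaps : (n k : ℕ) → List (Fin n → Fin k)
allMaps zero    k = (λ ()) ∷ []
allMaps (suc n) k = concatMap (λ a → map (a ∷ᶠ_) (allMaps n k)) (allFin k)

_==ᶠ_ : ∀ {k} → Fin k → Fin k → Bool
a ==ᶠ b = ⌊ a ≟ᶠ b ⌋

isProper : ∀ {n k} → Graph n → (Fin n → Fin k) → Bool
isProper {n} G c = all (λ i → all (λ j → not (adj G i j ∧ (c i ==ᶠ c j))) (allFin n)) (allFin n)

isOnto : ∀ {n k} → (Fin n → Fin k) → Bool
isOnto {n} {k} c = all (λ a → any (λ i → c i ==ᶠ a) (allFin n)) (allFin k)

equivColourings : ∀ {n k} → (Fin n → Fin k) → (Fin n → Fin k) → Bool
equivColourings {n} c d =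
  all (λ i → all (λ j → not ((c i ==ᶠ c j) xor (d i ==ᶠ d j))) (allFin n)) (allFin n)

S : ∀ {n} → Graph n → ℕ → ℕ
S {n} G k = length (deduplicateᵇ equivColourings
                     (filter (λ c → Data.Bool.T? (isProper G c ∧ isOnto c)) (allMaps n k)))
  where import Data.Bool

sumFrom1 : ℕ → (ℕ → ℕ) → ℕ
sumFrom1 zero    f = 0
sumFrom1 (suc m) f = sumFrom1 m f + f (suc m)

-- B(G) = Σ_{k≥1} S(G,k), T(G) = Σ_{k≥1} k S(G,k); S(G,k) = 0 for k > n,
-- so the sums are taken over 1 ≤ k ≤ n.
𝓑 : ∀ {n} → Graph n → ℕ
𝓑 {n} G = sumFrom1 n (S G)

𝓣 : ∀ {n} → Graph n → ℕ
𝓣 {n} G = sumFrom1 n (λ k → k * S G k)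

-- A(G) = T(G)/B(G) as a rational (B(G) ≥ 1 whenever n ≥ 1; value 0 if B(G) = 0)
𝓐 : ∀ {n} → Graph n → ℚ
𝓐 G with 𝓑 G
... | zero  = 0ℚ
... | suc m = (+ 𝓣 G) / suc m

{-# OPTIONS --safe #-}
module Submission where

open import Defs renaming (sym to adj-sym)
open import Data.Bool using (Bool; true; false; T; T?; _∧_; not; _xor_)
open import Data.Bool.ListAction using (all; and)
open import Data.Bool.Properties using (T-∧)
open import Data.Empty using (⊥-elim)
open import Data.Fin using (Fin; toℕ) renaming (zero to fzero; suc to fsuc; _<_ to _<ᶠ_)
open import Data.Fin.Patterns using (0F; 1F; 2F)
open import Data.Fin.Permutation using (Permutation; transpose; _∘ₚ_; _⟨$⟩ʳ_)
open import Data.Fin.Permutation.Components using () renaming (transpose to swap)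
open import Data.Fin.Properties using (any?; injective⇒≤; toℕ-injective)
  renaming (_≟_ to _≟ᶠ_; suc-injective to fsuc-injective; _<?_ to _<ᶠ?_; <-cmp to <ᶠ-cmp)
open import Data.Integer as ℤ using (+<+)
open import Data.Integer.Properties using (pos-*)
open import Data.List using (List; []; _∷_; map; foldr; length; _++_; filter; allFin; lookup; deduplicate; cartesianProduct; cartesianProductWith; tabulate)
open import Data.List.Membership.Propositional using (_∈_; lose; find)
open import Data.List.Membership.Propositional.Properties
open import Data.List.Properties using (map-cong; map-tabulate; map-++; map-∘; length-map)
open import Data.List.Relation.Unary.All as All using (All; []; _∷_)
open import Data.List.Relation.Unary.All.Properties using (all⁺; all⁻; all-filter)
open import Data.List.Relation.Unary.AllPairs as AllPairs using (AllPairs; []; _∷_)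
import Data.List.Relation.Unary.AllPairs.Properties as AllPairs
open import Data.List.Relation.Unary.Any as Any using (Any; here; there)
open import Data.List.Relation.Unary.Any.Properties as Any using (any⁺; any⁻)
open import Data.List.Relation.Unary.Unique.Propositional using (Unique)
import Data.List.Relation.Unary.Unique.Propositional.Properties as Unique
open import Data.Nat using (ℕ; zero; suc; _+_; _*_; _∸_; _^_; _≤_; _<_; _⊔_; z≤n; s≤s; _!; >-nonZero)
open import Data.Nat.ListAction using (sum; product)
open import Data.Nat.ListAction.Properties using (sum-++)
open import Data.Nat.Properties
open import Data.Nat.Tactic.RingSolver using (solve-∀)
open import Data.Product using (Σ; ∃; _×_; _,_; proj₁; proj₂)
open import Data.Rational using (ℚ; _/_; 0ℚ) renaming (_≤_ to _≤ℚ_; _<_ to _<ℚ_)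
import Data.Rational.Properties as ℚ
import Data.Rational.Unnormalised as ℚᵘ
import Data.Rational.Unnormalised.Properties as ℚᵘ
open import Data.Sum as Sum using (_⊎_; inj₁; inj₂)
open import Data.Unit using (tt)
open import Data.Vec.Functional using (updateAt)
open import Data.Vec.Functional.Properties using (updateAt-updates; updateAt-minimal)
open import Function using (_∘_; const; _⇔_; mk⇔; _↔_; Equivalence; Inverse)
open import Function.Construct.Identity using (↔-id)
open import Relation.Binary using (Decidable; Reflexive; Symmetric; Transitive; tri<; tri≈; tri>)
open import Relation.Binary.PropositionalEquality using (_≡_; _≢_; refl; sym; trans; cong; cong₂; subst; subst₂; module ≡-Reasoning)
open import Relation.Nullary using (¬_; Dec; yes; no; contradiction; ¬?; does; _×-dec_)
open import Relation.Nullary.Decidable using (toWitness; fromWitness; dec-true; dec-false)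
open import Algebra.Properties.Semiring.Sum +-*-semiring using (∑-comm)
  renaming (sum to ∑; sum-cong-≗ to ∑-cong; ∑-distrib-+ to ∑-+; *-distribˡ-sum to *-distribˡ-∑; *-distribʳ-sum to *-distribʳ-∑)

-- The average number of colours is compared through the chromatic polynomials. If X is the number of fixed points of a
-- uniformly random permutation of N points, then E[X (X-1) ... (X-k+1)] = 1 for k ≤ N; since the chromatic polynomial f
-- of G is the sum of S(G,k) x(x-1)...(x-k+1), we get E[f(X)] = 𝓑 G and E[X f(X)] = 𝓑 G + 𝓣 G. By Chebyshev's inequality
-- it therefore suffices that f(x) / h(x) is nondecreasing for x ≥ 2, where h = x^(n-2) (x-1)^2 belongs to K₁,₂ ∪ (n-3) K₁.
-- As the maximum degree is 2, f is x^n times a product of factors 1 - 1/x and c_m(x)/x^m with c_m the chromatic polynomial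
-- of the m-cycle, with one factor 1 - 1/x for each edge outside the cycles; for a product with at least two edges the ratio
-- to (1 - 1/x)^2 is nondecreasing, and it increases strictly from 3 to 4 once there are at least three edges.

-- Moments of the number of fixed points

-- The obstacle is the cycle factor. From c_m(x) = (x-1)^m + (-1)^m (x-1), the correction term helps
-- monotonicity for odd m and works against it for even m, where Bernoulli's inequality has to
-- absorb it. The margin is exactly zero once: for the 4-cycle, c_4(x) / (x^2 (x-1)^2) equals 1/2
-- both at x = 2 and at x = 3. This is why strictness is sought between 3 and 4. The number N of
-- permuted points has two tasks. The moment of X · X(X-1)...(X-n+1) requires n < N, and the strict
-- pair (3 , 4) must have positive weight, which holds when 4 points can be fixed and at least 2
-- others moved, so 6 ≤ N. With n ≥ 3, N = n + 3 does both. A graph of maximum degree 2 contains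
-- K₁,₂, so with at most two edges it already is the extremal graph; a strict inequality for three
-- or more edges therefore settles the equality case as well. All ratios are cross-multiplied and
-- all identities with a negative term are stated with that term moved to the other side, so that
-- everything stays in the natural numbers.

insert : ℕ → (ℕ → ℕ) → ℕ → ℕ
insert N f x = f (suc x) + (N ∸ x) * f x + x * f (x ∸ 1)

-- 𝕄 N f is the sum of f (number of fixed points of σ) over all permutations σ of N points:
-- the point N+1 is either fixed, or inserted into a cycle before a moved or a fixed point.
𝕄 : ℕ → (ℕ → ℕ) → ℕ
𝕄 zero    f = f 0
𝕄 (suc N) f = 𝕄 N (insert N f)

𝕄-mono : ∀ N {f g} → (∀ x → x ≤ N → f x ≤ g x) → 𝕄 N f ≤ 𝕄 N g
𝕄-mono zero    f≤g = f≤g 0 z≤n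
𝕄-mono (suc N) f≤g = 𝕄-mono N λ x x≤N →
  +-mono-≤ (+-mono-≤ (f≤g (suc x) (s≤s x≤N)) (*-monoʳ-≤ (N ∸ x) (f≤g x (m≤n⇒m≤1+n x≤N))))
           (*-monoʳ-≤ x (f≤g (x ∸ 1) (≤-trans (m∸n≤m x 1) (m≤n⇒m≤1+n x≤N))))

𝕄-cong : ∀ N {f g} → (∀ x → x ≤ N → f x ≡ g x) → 𝕄 N f ≡ 𝕄 N g
𝕄-cong N f≡g = ≤-antisym (𝕄-mono N λ x x≤N → ≤-reflexive (f≡g x x≤N))
                         (𝕄-mono N λ x x≤N → ≤-reflexive (sym (f≡g x x≤N)))

𝕄-cong-≗ : ∀ N {f g} → (∀ x → f x ≡ g x) → 𝕄 N f ≡ 𝕄 N g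
𝕄-cong-≗ N f≡g = 𝕄-cong N (λ x _ → f≡g x)

𝕄-+ : ∀ N f g → 𝕄 N (λ x → f x + g x) ≡ 𝕄 N f + 𝕄 N g
𝕄-+ zero    f g = refl
𝕄-+ (suc N) f g = trans (𝕄-cong-≗ N λ x → rearr (N ∸ x) x (f (suc x)) (f x) (f (x ∸ 1)) (g (suc x)) (g x) (g (x ∸ 1))) (𝕄-+ N (insert N f) (insert N g))
  where
  rearr : ∀ m x a b c a′ b′ c′ →
    a + a′ + m * (b + b′) + x * (c + c′) ≡ (a + m * b + x * c) + (a′ + m * b′ + x * c′)
  rearr = solve-∀

𝕄-*ˡ : ∀ N k f → 𝕄 N (λ x → k * f x) ≡ k * 𝕄 N f
𝕄-*ˡ zero    k f = refl
𝕄-*ˡ (suc N) k f = trans (𝕄-cong-≗ N λ x → rearr (N ∸ x) x k _ _ _) (𝕄-*ˡ N k (insert N f))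
  where
  rearr : ∀ m x k a b c → k * a + m * (k * b) + x * (k * c) ≡ k * (a + m * b + x * c)
  rearr = solve-∀

𝕄-*ʳ : ∀ N k f → 𝕄 N (λ x → f x * k) ≡ 𝕄 N f * k
𝕄-*ʳ N k f = trans (𝕄-cong-≗ N λ x → *-comm (f x) k) (trans (𝕄-*ˡ N k f) (*-comm k _))

𝕄-comm : ∀ N M (F : ℕ → ℕ → ℕ) → 𝕄 N (λ x → 𝕄 M (F x)) ≡ 𝕄 M (λ y → 𝕄 N (λ x → F x y))
𝕄-comm zero    M F = refl
𝕄-comm (suc N) M F = trans (𝕄-cong-≗ N insert-𝕄) (𝕄-comm N M (λ x y → insert N (λ x → F x y) x))
  where
  insert-𝕄 : ∀ x → insert N (λ x → 𝕄 M (F x)) x ≡ 𝕄 M (λ y → insert N (λ x → F x y) x)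
  insert-𝕄 x = begin
    𝕄 M (F (suc x)) + (N ∸ x) * 𝕄 M (F x) + x * 𝕄 M (F (x ∸ 1))
      ≡⟨ cong₂ (λ a b → 𝕄 M (F (suc x)) + a + b) (sym (𝕄-*ˡ M (N ∸ x) (F x))) (sym (𝕄-*ˡ M x (F (x ∸ 1)))) ⟩
    𝕄 M (F (suc x)) + 𝕄 M (λ y → (N ∸ x) * F x y) + 𝕄 M (λ y → x * F (x ∸ 1) y)
      ≡⟨ cong (_+ _) (sym (𝕄-+ M (F (suc x)) (λ y → (N ∸ x) * F x y))) ⟩
    𝕄 M (λ y → F (suc x) y + (N ∸ x) * F x y) + 𝕄 M (λ y → x * F (x ∸ 1) y)
      ≡⟨ sym (𝕄-+ M _ _) ⟩
    𝕄 M (λ y → insert N (λ x → F x y) x) ∎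
    where open ≡-Reasoning

-- Some permutation has exactly j fixed points: the other points, at least two, can form a single
-- cycle. With only one point left over there would be none. The recursion starts from the
-- transposition, lengthens the cycle, then adds fixed points.
𝕄-pos : ∀ N j {f} → j + 2 ≤ N → 0 < f j → 0 < 𝕄 N f
𝕄-pos (suc zero) zero (s≤s ()) f0
𝕄-pos (suc zero) (suc j) (s≤s p) fj = contradiction (≤-trans (m≤n+m 2 j) p) λ ()
𝕄-pos (suc (suc zero)) zero {f} _ f0 = subst (0 <_) (sym (two (f 2) (f 1) (f 0) (f 1 + 1 * f 0 + 0))) (≤-trans f0 (m≤n+m (f 0) (f 2)))
  where
  two : ∀ a b c d → a + 0 * b + 1 * c + 0 * d + 0 ≡ a + c
  two = solve-∀
𝕄-pos (suc (suc (suc N))) zero {f} p f0 = 𝕄-pos (suc (suc N)) 0 {insert (suc (suc N)) f} (s≤s (s≤s z≤n))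
  (≤-trans f0 (≤-trans (m≤m+n (f 0) _) (≤-trans (m≤n+m _ (f 1)) (m≤m+n _ _))))
𝕄-pos (suc (suc N)) (suc j) {f} (s≤s p) fj = 𝕄-pos (suc N) j {insert (suc N) f} p
  (≤-trans fj (≤-trans (m≤m+n _ _) (m≤m+n _ _)))

𝕄-mono-< : ∀ N j {f g} → (∀ x → x ≤ N → f x ≤ g x) → j + 2 ≤ N → f j < g j → 𝕄 N f < 𝕄 N g
𝕄-mono-< N j {f} {g} f≤g j≤N fj<gj = begin-strict
  𝕄 N f                              ≡⟨ +-identityʳ _ ⟨
  𝕄 N f + 0                          <⟨ +-monoʳ-< (𝕄 N f) (𝕄-pos N j j≤N (m<n⇒0<n∸m fj<gj)) ⟩
  𝕄 N f + 𝕄 N (λ x → g x ∸ f x)      ≡⟨ 𝕄-+ N f _ ⟨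
  𝕄 N (λ x → f x + (g x ∸ f x))      ≡⟨ 𝕄-cong N (λ x x≤N → m+[n∸m]≡n (f≤g x x≤N)) ⟩
  𝕄 N g                              ∎
  where open ≤-Reasoning

infix 9 _↓_
_↓_ : ℕ → ℕ → ℕ
x     ↓ zero  = 1
zero  ↓ suc k = 0
suc x ↓ suc k = suc x * x ↓ k

↓-suc : ∀ x k → x ↓ suc k + k * x ↓ k ≡ x * x ↓ k
↓-suc zero    zero    = refl
↓-suc zero    (suc k) = *-zeroʳ k
↓-suc (suc x) zero    = +-identityʳ _
↓-suc (suc x) (suc k) = begin
  suc x * x ↓ suc k + suc k * (suc x * x ↓ k) ≡⟨ lem x k (x ↓ suc k) (x ↓ k) ⟩
  suc x * (x ↓ suc k + k * x ↓ k) + suc x * x ↓ k ≡⟨ cong (λ a → suc x * a + suc x * x ↓ k) (↓-suc x k) ⟩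
  suc x * (x * x ↓ k) + suc x * x ↓ k ≡⟨ lem₂ x (x ↓ k) ⟩
  suc x * (suc x * x ↓ k) ∎
  where
  open ≡-Reasoning
  lem : ∀ x k a b → suc x * a + suc k * (suc x * b) ≡ suc x * (a + k * b) + suc x * b
  lem = solve-∀
  lem₂ : ∀ x b → suc x * (x * b) + suc x * b ≡ suc x * (suc x * b)
  lem₂ = solve-∀

↓-zero : ∀ {x k} → x < k → x ↓ k ≡ 0
↓-zero {zero}  {suc k} _       = refl
↓-zero {suc x} {suc k} (s≤s p) = trans (cong (suc x *_) (↓-zero p)) (*-zeroʳ (suc x))

↓-∸ : ∀ x k → x ↓ suc k ≡ (x ∸ k) * x ↓ k
↓-∸ x k with k ≤? x
... | yes k≤x = +-cancelʳ-≡ _ _ _ (trans (↓-suc x k) (trans (cong (_* x ↓ k) (sym (m∸n+n≡m k≤x))) (*-distribʳ-+ (x ↓ k) (x ∸ k) k)))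
... | no  k≰x = trans (↓-zero (m≤n⇒m≤1+n (≰⇒> k≰x)))
                      (sym (trans (cong ((x ∸ k) *_) (↓-zero (≰⇒> k≰x))) (*-zeroʳ (x ∸ k))))

-- Ordered (k+1)-tuples of fixed points after inserting a point: either the new point is fixed and
-- occupies one of k+1 positions of the tuple, or the tuple is old and the new point avoids the k+1
-- insertions that would unfix a member, out of N+1.
insert-↓ : ∀ N x k → x ≤ N →
  insert N (λ x → x ↓ suc k) x + suc k * x ↓ suc k ≡ suc N * x ↓ suc k + suc k * x ↓ k
insert-↓ N x k x≤N = begin
  suc x * x ↓ k + (N ∸ x) * x ↓ suc k + x * (x ∸ 1) ↓ suc k + suc k * x ↓ suc k
    ≡⟨ cong₂ (λ a b → a + (N ∸ x) * x ↓ suc k + b + suc k * x ↓ suc k) (cong (x ↓ k +_) (sym (↓-suc x k))) (shift x) ⟩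
  x ↓ k + (x ↓ suc k + k * x ↓ k) + (N ∸ x) * x ↓ suc k + x ↓ suc (suc k) + suc k * x ↓ suc k
    ≡⟨ lem (x ↓ k) _ k (N ∸ x) _ ⟩
  suc k * x ↓ k + suc (N ∸ x) * x ↓ suc k + (x ↓ suc (suc k) + suc k * x ↓ suc k)
    ≡⟨ cong (suc k * x ↓ k + suc (N ∸ x) * x ↓ suc k +_) (↓-suc x (suc k)) ⟩
  suc k * x ↓ k + suc (N ∸ x) * x ↓ suc k + x * x ↓ suc k
    ≡⟨ lem₂ _ (x ↓ suc k) (N ∸ x) x ⟩
  suc (N ∸ x + x) * x ↓ suc k + suc k * x ↓ k
    ≡⟨ cong (λ a → suc a * x ↓ suc k + suc k * x ↓ k) (m∸n+n≡m x≤N) ⟩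
  suc N * x ↓ suc k + suc k * x ↓ k ∎
  where
  open ≡-Reasoning
  shift : ∀ x → x * (x ∸ 1) ↓ suc k ≡ x ↓ suc (suc k)
  shift zero    = refl
  shift (suc x) = refl
  lem : ∀ a b k m c → a + (b + k * a) + m * b + c + suc k * b ≡ suc k * a + suc m * b + (c + suc k * b)
  lem = solve-∀
  lem₂ : ∀ s b m x → s + suc m * b + x * b ≡ suc (m + x) * b + s
  lem₂ = solve-∀

-- Each of the N!/(N-k)! ordered k-tuples of distinct points is fixed by (N-k)! permutations, so the
-- value does not depend on k.
𝕄-↓ : ∀ N k → k ≤ N → 𝕄 N (_↓ k) ≡ N !
𝕄-↓ zero    zero    _ = refl
𝕄-↓ (suc N) zero    _ = begin
  𝕄 N (insert N (λ _ → 1))  ≡⟨ 𝕄-cong N (λ x x≤N → trans (lem (N ∸ x) x) (cong (λ a → suc a * 1) (m∸n+n≡m x≤N))) ⟩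
  𝕄 N (λ x → suc N * 1)     ≡⟨ 𝕄-*ˡ N (suc N) (_↓ 0) ⟩
  suc N * 𝕄 N (_↓ 0)        ≡⟨ cong (suc N *_) (𝕄-↓ N 0 z≤n) ⟩
  suc N * N !               ∎
  where
  open ≡-Reasoning
  lem : ∀ m x → 1 + m * 1 + x * 1 ≡ suc (m + x) * 1
  lem = solve-∀
𝕄-↓ (suc N) (suc k) (s≤s k≤N) = +-cancelʳ-≡ (suc k * 𝕄 N (_↓ suc k)) _ _ (begin
  𝕄 N (insert N (_↓ suc k)) + suc k * 𝕄 N (_↓ suc k)
    ≡⟨ cong (𝕄 N (insert N (_↓ suc k)) +_) (sym (𝕄-*ˡ N (suc k) (_↓ suc k))) ⟩
  𝕄 N (insert N (_↓ suc k)) + 𝕄 N (λ x → suc k * x ↓ suc k)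
    ≡⟨ sym (𝕄-+ N _ _) ⟩
  𝕄 N (λ x → insert N (_↓ suc k) x + suc k * x ↓ suc k)
    ≡⟨ 𝕄-cong N (λ x → insert-↓ N x k) ⟩
  𝕄 N (λ x → suc N * x ↓ suc k + suc k * x ↓ k)
    ≡⟨ trans (𝕄-+ N _ _) (cong₂ _+_ (𝕄-*ˡ N (suc N) (_↓ suc k)) (𝕄-*ˡ N (suc k) (_↓ k))) ⟩
  suc N * 𝕄 N (_↓ suc k) + suc k * 𝕄 N (_↓ k)
    ≡⟨ cong (λ a → suc N * 𝕄 N (_↓ suc k) + suc k * a) (𝕄-↓ N k k≤N) ⟩
  suc N * 𝕄 N (_↓ suc k) + suc k * N !
    ≡⟨ last ⟩
  suc N ! + suc k * 𝕄 N (_↓ suc k) ∎)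
  where
  open ≡-Reasoning
  last : suc N * 𝕄 N (_↓ suc k) + suc k * N ! ≡ suc N ! + suc k * 𝕄 N (_↓ suc k)
  last with suc k ≤? N
  ... | yes 1+k≤N rewrite 𝕄-↓ N (suc k) 1+k≤N = refl
  -- Here k = N, beyond the reach of the induction hypothesis for k+1; but `x ↓ suc N` vanishes for
  -- all x ≤ N, so its moment is 0.
  ... | no  1+k≰N rewrite ≤-antisym k≤N (≤-pred (≰⇒> 1+k≰N))
                        | 𝕄-cong N {_↓ suc N} {λ _ → 0 * 1} (λ x x≤N → ↓-zero (s≤s x≤N))
                        | 𝕄-*ˡ N 0 (λ _ → 1) | *-zeroʳ N = +-comm 0 _

𝕄-*↓ : ∀ N k → k < N → 𝕄 N (λ x → x * x ↓ k) ≡ suc k * N !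
𝕄-*↓ N k k<N = begin
  𝕄 N (λ x → x * x ↓ k)               ≡⟨ 𝕄-cong-≗ N (λ x → sym (↓-suc x k)) ⟩
  𝕄 N (λ x → x ↓ suc k + k * x ↓ k)   ≡⟨ trans (𝕄-+ N _ _) (cong₂ _+_ (𝕄-↓ N (suc k) k<N) (𝕄-*ˡ N k (_↓ k))) ⟩
  N ! + k * 𝕄 N (_↓ k)                ≡⟨ cong (λ a → N ! + k * a) (𝕄-↓ N k (<⇒≤ k<N)) ⟩
  suc k * N !                         ∎
  where open ≡-Reasoning

-- Chebyshev's sum inequality, symmetrised over pairs (x , y).
module _ (N : ℕ) {f h : ℕ → ℕ} (ratio : ∀ {x y} → x < y → f x * h y ≤ f y * h x) where

  private
    -- The difference `upper x y` - `lower x y` is (y - x)(f y · h x - f x · h y), whose two factors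
    -- have the same sign by `ratio`.
    lower upper : ℕ → ℕ → ℕ
    lower x y = x * h x * f y + y * h y * f x
    upper x y = x * f x * h y + y * f y * h x

    double : ∀ (p q : ℕ → ℕ) →
      𝕄 N (λ x → 𝕄 N (λ y → x * p x * q y + y * p y * q x)) ≡ 2 * (𝕄 N (λ x → x * p x) * 𝕄 N q)
    double p q = begin
      𝕄 N (λ x → 𝕄 N (λ y → x * p x * q y + y * p y * q x))
        ≡⟨ 𝕄-cong-≗ N (λ x → trans (𝕄-+ N _ _) (cong₂ _+_ (𝕄-*ˡ N (x * p x) q) (𝕄-*ʳ N (q x) (λ y → y * p y)))) ⟩
      𝕄 N (λ x → x * p x * 𝕄 N q + 𝕄 N (λ y → y * p y) * q x)
        ≡⟨ trans (𝕄-+ N _ _) (cong₂ _+_ (𝕄-*ʳ N (𝕄 N q) (λ x → x * p x)) (𝕄-*ˡ N (𝕄 N (λ y → y * p y)) q)) ⟩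
      𝕄 N (λ x → x * p x) * 𝕄 N q + 𝕄 N (λ x → x * p x) * 𝕄 N q
        ≡⟨ cong (𝕄 N (λ x → x * p x) * 𝕄 N q +_) (+-identityʳ _) ⟨
      2 * (𝕄 N (λ x → x * p x) * 𝕄 N q) ∎
      where open ≡-Reasoning

    lower≡ : ∀ x d → lower x (x + d) ≡
      x * (f (x + d) * h x) + x * (f x * h (x + d)) + d * (f x * h (x + d))
    lower≡ x d = lem x d (h x) (f (x + d)) (h (x + d)) (f x)
      where
      lem : ∀ x d a b p q → x * a * b + (x + d) * p * q ≡ x * (b * a) + x * (q * p) + d * (q * p)
      lem = solve-∀

    upper≡ : ∀ x d → upper x (x + d) ≡
      x * (f (x + d) * h x) + x * (f x * h (x + d)) + d * (f (x + d) * h x)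
    upper≡ x d = lem x d (h x) (f (x + d)) (h (x + d)) (f x)
      where
      lem : ∀ x d a b p q → x * q * p + (x + d) * b * a ≡ x * (b * a) + x * (q * p) + d * (b * a)
      lem = solve-∀

    lower≤upper-+ : ∀ x d → lower x (x + suc d) ≤ upper x (x + suc d)
    lower≤upper-+ x d rewrite lower≡ x (suc d) | upper≡ x (suc d) =
      +-monoʳ-≤ (x * (f (x + suc d) * h x) + x * (f x * h (x + suc d))) (*-monoʳ-≤ (suc d) (ratio (m<m+n x (s≤s z≤n))))

    lower<upper-+ : ∀ x d → f x * h (x + suc d) < f (x + suc d) * h x → lower x (x + suc d) < upper x (x + suc d)
    lower<upper-+ x d p rewrite lower≡ x (suc d) | upper≡ x (suc d) =
      +-monoʳ-< (x * (f (x + suc d) * h x) + x * (f x * h (x + suc d))) (*-monoʳ-< (suc d) p)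

    lower≤upper : ∀ x y → lower x y ≤ upper x y
    lower≤upper x y with <-cmp x y
    ... | tri< x<y _ _ with y ∸ x | m+[n∸m]≡n (<⇒≤ x<y)
    ...   | zero  | eq = contradiction (trans (sym (+-identityʳ x)) eq) (<⇒≢ x<y)
    ...   | suc d | refl = lower≤upper-+ x d
    lower≤upper x y | tri≈ _ refl _ = ≤-reflexive (lem x (h x) (f x))
      where
      lem : ∀ x a b → x * a * b + x * a * b ≡ x * b * a + x * b * a
      lem = solve-∀
    lower≤upper x y | tri> _ _ y<x with x ∸ y | m+[n∸m]≡n (<⇒≤ y<x)
    ...   | zero  | eq = contradiction (trans (sym (+-identityʳ y)) eq) (<⇒≢ y<x)
    ...   | suc d | refl = subst₂′ (lower≤upper-+ y d)
      where
      subst₂′ : lower y (y + suc d) ≤ upper y (y + suc d) → lower (y + suc d) y ≤ upper (y + suc d) y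
      subst₂′ p rewrite +-comm ((y + suc d) * h (y + suc d) * f y) (y * h y * f (y + suc d))
                      | +-comm ((y + suc d) * f (y + suc d) * h y) (y * f y * h (y + suc d)) = p

  -- One strict pair suffices, as it occurs in the double sum over permutations: the bound on N
  -- provides permutations with x and with x+d+1 fixed points.
  chebyshev-< : ∀ x d → x + suc d + 2 ≤ N → f x * h (x + suc d) < f (x + suc d) * h x →
    𝕄 N (λ x → x * h x) * 𝕄 N f < 𝕄 N (λ x → x * f x) * 𝕄 N h
  chebyshev-< x d y≤N p = *-cancelˡ-< 2 _ _ (begin-strict
    2 * (𝕄 N (λ x → x * h x) * 𝕄 N f)  ≡⟨ double h f ⟨
    𝕄 N (λ x → 𝕄 N (lower x))         <⟨ 𝕄-mono-< N x (λ x _ → 𝕄-mono N (λ y _ → lower≤upper x y))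
                                           (≤-trans (+-monoˡ-≤ 2 (m≤m+n x (suc d))) y≤N)
                                           (𝕄-mono-< N (x + suc d) (λ y _ → lower≤upper x y) y≤N (lower<upper-+ x d p)) ⟩
    𝕄 N (λ x → 𝕄 N (upper x))         ≡⟨ double f h ⟩
    2 * (𝕄 N (λ x → x * f x) * 𝕄 N h)  ∎)
    where open ≤-Reasoning

-- Monotone ratios of chromatic polynomials of paths and cycles

-- The numbers of walks of length k in the complete graph on x vertices between
-- two given vertices: equal ones for closedWalks, distinct ones for openWalks.
closedWalks openWalks : ℕ → ℕ → ℕ
closedWalks zero    x = 1
closedWalks (suc k) x = (x ∸ 1) * openWalks k x
openWalks zero    x = 0
openWalks (suc k) x = closedWalks k x + (x ∸ 2) * openWalks k x

walks-total : ∀ k z → closedWalks k (2 + z) + suc z * openWalks k (2 + z) ≡ suc z ^ k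
walks-total zero    z = cong suc (*-zeroʳ z)
walks-total (suc k) z = trans (lem z (closedWalks k (2 + z)) (openWalks k (2 + z))) (cong (suc z *_) (walks-total k z))
  where
  lem : ∀ z a b → suc z * b + suc z * (a + z * b) ≡ suc z * (a + suc z * b)
  lem = solve-∀

-- The first-order recursion b_{k+1} + b_k = (x-1)^k, from which the alternating closed form
-- follows.
openWalks-suc : ∀ k z → openWalks (suc k) (2 + z) + openWalks k (2 + z) ≡ suc z ^ k
openWalks-suc k z = trans (lem z (closedWalks k (2 + z)) (openWalks k (2 + z))) (walks-total k z)
  where
  lem : ∀ z a b → a + z * b + b ≡ a + suc z * b
  lem = solve-∀

-- This is x b_k = (x-1)^k - (-1)^k, split by sign. The sign depends on k alone, so the alternative
-- is chosen before z; later the same one is used at two consecutive values of x.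
openWalks-closed : ∀ k →
  (∀ z → openWalks k (2 + z) * (2 + z) + 1 ≡ suc z ^ k) ⊎
  (∀ z → openWalks k (2 + z) * (2 + z) ≡ suc z ^ k + 1)
openWalks-closed zero = inj₁ λ z → refl
openWalks-closed (suc k) with openWalks-closed k
... | inj₁ even = inj₂ λ z → +-cancelʳ-≡ (openWalks k (2 + z) * (2 + z)) _ _ (begin
  openWalks (suc k) (2 + z) * (2 + z) + openWalks k (2 + z) * (2 + z)
    ≡⟨ *-distribʳ-+ (2 + z) (openWalks (suc k) (2 + z)) (openWalks k (2 + z)) ⟨
  (openWalks (suc k) (2 + z) + openWalks k (2 + z)) * (2 + z)
    ≡⟨ cong (_* (2 + z)) (openWalks-suc k z) ⟩
  suc z ^ k * (2 + z)
    ≡⟨ lem (suc z ^ k) z ⟩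
  suc z ^ suc k + suc z ^ k
    ≡⟨ cong (suc z ^ suc k +_) (even z) ⟨
  suc z ^ suc k + (openWalks k (2 + z) * (2 + z) + 1)
    ≡⟨ lem₂ (suc z ^ suc k) (openWalks k (2 + z) * (2 + z)) ⟩
  suc z ^ suc k + 1 + openWalks k (2 + z) * (2 + z) ∎)
  where
  open ≡-Reasoning
  lem : ∀ p z → p * (2 + z) ≡ suc z * p + p
  lem = solve-∀
  lem₂ : ∀ a b → a + (b + 1) ≡ a + 1 + b
  lem₂ = solve-∀
... | inj₂ odd = inj₁ λ z → +-cancelʳ-≡ (suc z ^ k) _ _ (begin
  openWalks (suc k) (2 + z) * (2 + z) + 1 + suc z ^ k
    ≡⟨ lem₁ (openWalks (suc k) (2 + z) * (2 + z)) (suc z ^ k) ⟩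
  openWalks (suc k) (2 + z) * (2 + z) + (suc z ^ k + 1)
    ≡⟨ cong (openWalks (suc k) (2 + z) * (2 + z) +_) (odd z) ⟨
  openWalks (suc k) (2 + z) * (2 + z) + openWalks k (2 + z) * (2 + z)
    ≡⟨ *-distribʳ-+ (2 + z) (openWalks (suc k) (2 + z)) (openWalks k (2 + z)) ⟨
  (openWalks (suc k) (2 + z) + openWalks k (2 + z)) * (2 + z)
    ≡⟨ cong (_* (2 + z)) (openWalks-suc k z) ⟩
  suc z ^ k * (2 + z)
    ≡⟨ lem (suc z ^ k) z ⟩
  suc z ^ suc k + suc z ^ k ∎)
  where
  open ≡-Reasoning
  lem : ∀ p z → p * (2 + z) ≡ suc z * p + p
  lem = solve-∀
  lem₁ : ∀ a b → a + 1 + b ≡ a + (b + 1)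
  lem₁ = solve-∀

-- Monotonicity of f / h, from x = 2 + z to x + 1: chromatic polynomials of graphs with an edge vanish for x < 2.
RatioUp RatioUp< : (h f : ℕ → ℕ) → ℕ → Set
RatioUp  h f z = f (2 + z) * h (3 + z) ≤ f (3 + z) * h (2 + z)
RatioUp< h f z = f (2 + z) * h (3 + z) < f (3 + z) * h (2 + z)

infixl 7 _⊗_
_⊗_ : (ℕ → ℕ) → (ℕ → ℕ) → ℕ → ℕ
(f ⊗ g) x = f x * g x

private
  interchange : ∀ a b c d → a * b * (c * d) ≡ a * c * (b * d)
  interchange = solve-∀

⊗-mono : ∀ h f h′ f′ z → RatioUp h f z → RatioUp h′ f′ z → RatioUp (h ⊗ h′) (f ⊗ f′) z
⊗-mono h f h′ f′ z p q = begin
  f (2 + z) * f′ (2 + z) * (h (3 + z) * h′ (3 + z))   ≡⟨ interchange (f (2 + z)) _ _ _ ⟩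
  f (2 + z) * h (3 + z) * (f′ (2 + z) * h′ (3 + z))   ≤⟨ *-mono-≤ p q ⟩
  f (3 + z) * h (2 + z) * (f′ (3 + z) * h′ (2 + z))   ≡⟨ interchange (f (3 + z)) (h (2 + z)) _ _ ⟩
  f (3 + z) * f′ (3 + z) * (h (2 + z) * h′ (2 + z))   ∎
  where open ≤-Reasoning

⊗-mono-< : ∀ h f h′ f′ z → RatioUp< h f z → RatioUp h′ f′ z → 0 < f′ (3 + z) * h′ (2 + z) →
           RatioUp< (h ⊗ h′) (f ⊗ f′) z
⊗-mono-< h f h′ f′ z p q pos = begin-strict
  f (2 + z) * f′ (2 + z) * (h (3 + z) * h′ (3 + z))   ≡⟨ interchange (f (2 + z)) _ _ _ ⟩
  f (2 + z) * h (3 + z) * (f′ (2 + z) * h′ (3 + z))   ≤⟨ *-monoʳ-≤ (f (2 + z) * h (3 + z)) q ⟩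
  f (2 + z) * h (3 + z) * (f′ (3 + z) * h′ (2 + z))   <⟨ *-monoˡ-< (f′ (3 + z) * h′ (2 + z)) {{>-nonZero pos}} p ⟩
  f (3 + z) * h (2 + z) * (f′ (3 + z) * h′ (2 + z))   ≡⟨ interchange (f (3 + z)) (h (2 + z)) _ _ ⟩
  f (3 + z) * f′ (3 + z) * (h (2 + z) * h′ (2 + z))   ∎
  where open ≤-Reasoning

pathPoly : ℕ → ℕ → ℕ
pathPoly p x = (x ∸ 1) ^ p

power : ℕ → ℕ → ℕ
power e x = x ^ e

-- The chromatic polynomial of the cycle with k + 1 vertices (for k ≥ 2).
cyclePoly : ℕ → ℕ → ℕ
cyclePoly k x = x * (x ∸ 1) * openWalks k x

bernoulli : ∀ u m → u ^ suc m + suc m * u ^ m ≤ suc u ^ suc m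
bernoulli u zero = ≤-reflexive (lem u)
  where
  lem : ∀ u → u * 1 + 1 ≡ suc u * 1
  lem = solve-∀
bernoulli u (suc m) = begin
  u * u ^ suc m + suc (suc m) * u ^ suc m            ≤⟨ m≤m+n _ (suc m * u ^ m) ⟩
  u * u ^ suc m + suc (suc m) * u ^ suc m + suc m * u ^ m ≡⟨ lem u (u ^ m) m ⟩
  suc u * (u ^ suc m + suc m * u ^ m)                ≤⟨ *-monoʳ-≤ (suc u) (bernoulli u m) ⟩
  suc u * suc u ^ suc m                              ∎
  where
  open ≤-Reasoning
  lem : ∀ u p m → u * (u * p) + suc (suc m) * (u * p) + suc m * p ≡ suc u * (u * p + suc m * p)
  lem = solve-∀

^-distribʳ-* : ∀ a b n → (a * b) ^ n ≡ a ^ n * b ^ n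
^-distribʳ-* a b zero    = refl
^-distribʳ-* a b (suc n) = trans (cong (a * b *_) (^-distribʳ-* a b n)) (interchange a b (a ^ n) (b ^ n))

-- With w = x - 1 ≥ 1 and u = w (w + 2) = (w + 1)² - 1, multiplying by (w + 1)(w + 2) turns the monotonicity of
-- openWalks k x / (x ^ (k - 2) (x - 1)) into a comparison of w u^(k-1) with w (u + 1)^(k-1), up to lower terms.
private
  u : ℕ → ℕ
  u w = w * (2 + w)

  1+u : ∀ w → suc (u w) ≡ suc w * suc w
  1+u = lem
    where
    lem : ∀ w → suc (w * (2 + w)) ≡ suc w * suc w
    lem = solve-∀

  power-u : ∀ w M → w ^ suc M * (2 + w) ^ M ≡ w * u w ^ M
  power-u w M = trans (*-assoc w (w ^ M) _) (cong (w *_) (sym (^-distribʳ-* w (2 + w) M)))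

  power-1+u : ∀ w j → suc w ^ suc (suc j) * (suc w ^ j * w) ≡ w * suc (u w) ^ suc j
  power-1+u w j = trans (lem w (suc w ^ j)) (cong (w *_) (trans (sym (^-distribʳ-* (suc w) (suc w) (suc j))) (cong (_^ suc j) (sym (1+u w)))))
    where
    lem : ∀ w p → suc w * (suc w * p) * (p * w) ≡ w * (suc w * p * (suc w * p))
    lem = solve-∀

  module Even {w j p q : ℕ} (w>0 : 0 < w) (hp : p + 1 ≡ w ^ suc (suc j)) (hq : q + 1 ≡ suc w ^ suc (suc j)) where
    open ≤-Reasoning
    -- The corrections -1 are favourable: the left side loses (w+2)^(j+1), the right side only the
    -- smaller w (w+1)^j.
    even< : p * (2 + w) ^ suc j < q * (suc w ^ j * w)
    even< = +-cancelʳ-< ((2 + w) ^ suc j) _ _ (begin-strict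
      p * (2 + w) ^ suc j + (2 + w) ^ suc j    ≡⟨ lem p ((2 + w) ^ suc j) ⟩
      (p + 1) * (2 + w) ^ suc j                ≡⟨ trans (cong (_* (2 + w) ^ suc j) hp) (power-u w (suc j)) ⟩
      w * u w ^ suc j                          <⟨ *-monoʳ-< w {{>-nonZero w>0}} (^-monoˡ-< (suc j) (n<1+n (u w))) ⟩
      w * suc (u w) ^ suc j                    ≡⟨ trans (cong (_* (suc w ^ j * w)) hq) (power-1+u w j) ⟨
      (q + 1) * (suc w ^ j * w)                ≡⟨ lem q (suc w ^ j * w) ⟨
      q * (suc w ^ j * w) + suc w ^ j * w      ≤⟨ +-monoʳ-≤ (q * (suc w ^ j * w)) lower ⟩
      q * (suc w ^ j * w) + (2 + w) ^ suc j    ∎)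
      where
      lem : ∀ p a → p * a + a ≡ (p + 1) * a
      lem = solve-∀
      lower : suc w ^ j * w ≤ (2 + w) ^ suc j
      lower = begin
        suc w ^ j * w            ≤⟨ *-mono-≤ (^-monoˡ-≤ j (n≤1+n (suc w))) (m≤n+m w 2) ⟩
        (2 + w) ^ j * (2 + w)    ≡⟨ *-comm ((2 + w) ^ j) _ ⟩
        (2 + w) ^ suc j          ∎

  module Odd {w j p q : ℕ} (hp : p ≡ w ^ suc (suc (suc j)) + 1) (hq : q ≡ suc w ^ suc (suc (suc j)) + 1) where
    open ≤-Reasoning
    M = suc (suc j)

    lhs : p * (2 + w) ^ M ≡ w * u w ^ M + (2 + w) ^ M
    lhs = trans (cong (_* (2 + w) ^ M) hp) (trans (*-distribʳ-+ ((2 + w) ^ M) (w ^ suc M) 1)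
            (cong₂ _+_ (power-u w M) (+-identityʳ _)))

    rhs : q * (suc w ^ suc j * w) ≡ w * suc (u w) ^ M + suc w ^ suc j * w
    rhs = trans (cong (_* (suc w ^ suc j * w)) hq) (trans (*-distribʳ-+ (suc w ^ suc j * w) (suc w ^ suc M) 1)
            (cong₂ _+_ (power-1+u w (suc j)) (+-identityʳ _)))

    -- Bernoulli's inequality for u + 1, times w; the gap w M u^(M-1) is rewritten with u = w (w+2).
    bound : w * u w ^ M + (M * w ^ M) * (2 + w) ^ suc j ≤ w * suc (u w) ^ M
    bound = begin
      w * u w ^ M + (M * w ^ M) * (2 + w) ^ suc j
        ≡⟨ lem w (u w ^ M) M (w ^ suc j) _ ⟩
      w * (u w ^ M + M * (w ^ suc j * (2 + w) ^ suc j))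
        ≡⟨ cong (λ a → w * (u w ^ M + M * a)) (^-distribʳ-* w (2 + w) (suc j)) ⟨
      w * (u w ^ M + M * u w ^ suc j)
        ≤⟨ *-monoʳ-≤ w (bernoulli (u w) (suc j)) ⟩
      w * suc (u w) ^ M ∎
      where
      lem : ∀ w a m c d → w * a + m * (w * c) * d ≡ w * (a + m * (c * d))
      lem = solve-∀

    -- The correction +1 adds (w+2)^M on the left. After division by (w+2)^(j+1), `big` says that
    -- the Bernoulli gap covers it. For w > 0 it fails only at w = 1, M = 2, which is the 4-cycle at
    -- x = 2.
    module _ (big : 2 + w ≤ M * w ^ M) where
      odd-≤ : p * (2 + w) ^ M ≤ w * suc (u w) ^ M
      odd-≤ = begin
        p * (2 + w) ^ M                                    ≡⟨ lhs ⟩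
        w * u w ^ M + (2 + w) * (2 + w) ^ suc j            ≤⟨ +-monoʳ-≤ (w * u w ^ M) (*-monoˡ-≤ ((2 + w) ^ suc j) big) ⟩
        w * u w ^ M + (M * w ^ M) * (2 + w) ^ suc j        ≤⟨ bound ⟩
        w * suc (u w) ^ M                                  ∎

      odd< : 0 < w → p * (2 + w) ^ M < q * (suc w ^ suc j * w)
      odd< w>0 = begin-strict
        p * (2 + w) ^ M                            ≤⟨ odd-≤ ⟩
        w * suc (u w) ^ M                          <⟨ m<m+n _ (*-mono-< {0} {suc w ^ suc j} (m^n>0 (suc w) (suc j)) w>0) ⟩
        w * suc (u w) ^ M + suc w ^ suc j * w      ≡⟨ rhs ⟨
        q * (suc w ^ suc j * w)                    ∎

2+w≤M*w^M : ∀ v j → 4 + v ≤ (2 + j) * (2 + v) ^ (2 + j)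
2+w≤M*w^M v j = begin
  4 + v                       ≤⟨ +-monoʳ-≤ 4 (m≤m+n v (v + 0)) ⟩
  4 + 2 * v                   ≡⟨ lem v ⟩
  2 * (2 + v) ^ 1             ≤⟨ *-mono-≤ (m≤m+n 2 j) (^-monoʳ-≤ (2 + v) (m≤m+n 1 (suc j))) ⟩
  (2 + j) * (2 + v) ^ (2 + j) ∎
  where
  open ≤-Reasoning
  lem : ∀ v → 4 + 2 * v ≡ 2 * ((2 + v) * 1)
  lem = solve-∀

private
  -- Dividing c_m(x)/x^m by (1 - 1/x)^2 for m = k + 1 leaves b_k(x) / (x^(k-2) (x-1)); with k = j +
  -- 2 the denominator is `base j`.
  base : ℕ → ℕ → ℕ
  base e x = x ^ e * (x ∸ 1)

  clear : ∀ {z j} →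
    openWalks (2 + j) (2 + z) * (2 + z) * (3 + z) ^ suc j ≤ openWalks (2 + j) (3 + z) * (3 + z) * ((2 + z) ^ j * suc z) →
    RatioUp (base j) (openWalks (2 + j)) z
  clear {z} {j} p = *-cancelʳ-≤ _ _ (3 + z) (begin
    openWalks (2 + j) (2 + z) * ((3 + z) ^ j * (2 + z)) * (3 + z)    ≡⟨ lem (openWalks (2 + j) (2 + z)) z ((3 + z) ^ j) ⟩
    openWalks (2 + j) (2 + z) * (2 + z) * (3 + z) ^ suc j            ≤⟨ p ⟩
    openWalks (2 + j) (3 + z) * (3 + z) * ((2 + z) ^ j * suc z)      ≡⟨ lem₂ (openWalks (2 + j) (3 + z)) z _ ⟩
    openWalks (2 + j) (3 + z) * ((2 + z) ^ j * suc z) * (3 + z)      ∎)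
    where
    open ≤-Reasoning
    lem : ∀ b z p → b * (p * (2 + z)) * (3 + z) ≡ b * (2 + z) * ((3 + z) * p)
    lem = solve-∀
    lem₂ : ∀ b z p → b * (3 + z) * p ≡ b * p * (3 + z)
    lem₂ = solve-∀

  clear< : ∀ {z j} →
    openWalks (2 + j) (2 + z) * (2 + z) * (3 + z) ^ suc j < openWalks (2 + j) (3 + z) * (3 + z) * ((2 + z) ^ j * suc z) →
    RatioUp< (base j) (openWalks (2 + j)) z
  clear< {z} {j} p = *-cancelʳ-< (3 + z) _ _ (begin-strict
    openWalks (2 + j) (2 + z) * ((3 + z) ^ j * (2 + z)) * (3 + z)    ≡⟨ lem (openWalks (2 + j) (2 + z)) z ((3 + z) ^ j) ⟩
    openWalks (2 + j) (2 + z) * (2 + z) * (3 + z) ^ suc j            <⟨ p ⟩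
    openWalks (2 + j) (3 + z) * (3 + z) * ((2 + z) ^ j * suc z)      ≡⟨ lem₂ (openWalks (2 + j) (3 + z)) z _ ⟩
    openWalks (2 + j) (3 + z) * ((2 + z) ^ j * suc z) * (3 + z)      ∎)
    where
    open ≤-Reasoning
    lem : ∀ b z p → b * (p * (2 + z)) * (3 + z) ≡ b * (2 + z) * ((3 + z) * p)
    lem = solve-∀
    lem₂ : ∀ b z p → b * (3 + z) * p ≡ b * p * (3 + z)
    lem₂ = solve-∀

openWalks-up< : ∀ j z → RatioUp< (base j) (openWalks (2 + j)) (suc z)
-- The triangle: b_2 = x - 2, and the cross-multiplied ratios (x-2)/(x-1) at consecutive arguments
-- differ by exactly 1.
openWalks-up< zero z = ≤-reflexive (lem z)
  where
  lem : ∀ z → suc (((2 + z) * 0 + suc z * (1 + suc z * 0)) * (1 * (3 + z))) ≡ ((3 + z) * 0 + (2 + z) * (1 + (2 + z) * 0)) * (1 * (2 + z))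
  lem = solve-∀
openWalks-up< (suc j) z with openWalks-closed (3 + j)
... | inj₁ even = clear< {j = suc j} (Even.even< {2 + z} {suc j} (s≤s z≤n) (even (suc z)) (even (2 + z)))
... | inj₂ odd  = clear< {j = suc j} (Odd.odd< {2 + z} {j} (odd (suc z)) (odd (2 + z)) (2+w≤M*w^M z j) (s≤s z≤n))

openWalks-up : ∀ j z → RatioUp (base j) (openWalks (2 + j)) z
openWalks-up j (suc z) = <⇒≤ (openWalks-up< j z)
-- The triangle has no colouring with two colours.
openWalks-up zero zero = z≤n
openWalks-up (suc j) zero with openWalks-closed (3 + j)
... | inj₁ even = clear {j = suc j} (<⇒≤ (Even.even< {1} {suc j} (s≤s z≤n) (even 0) (even 1)))
... | inj₂ odd with j
...   | zero = ≤-refl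
...   | suc i = clear {j = 2 + i} (<⇒≤ (Odd.odd< {1} {suc i} (odd 0) (odd 1) big (s≤s z≤n)))
  where
  big : 3 ≤ (3 + i) * 1 ^ (3 + i)
  big = ≤-trans (m≤m+n 3 i) (≤-reflexive (sym (trans (cong ((3 + i) *_) (^-zeroˡ (3 + i))) (*-identityʳ _))))

RatioUp-cong : ∀ {h h′ f f′ z} → (∀ x → h x ≡ h′ x) → (∀ x → f x ≡ f′ x) → RatioUp h f z → RatioUp h′ f′ z
RatioUp-cong {z = z} h≗ f≗ p rewrite sym (h≗ (2 + z)) | sym (h≗ (3 + z)) | sym (f≗ (2 + z)) | sym (f≗ (3 + z)) = p

RatioUp<-cong : ∀ {h h′ f f′ z} → (∀ x → h x ≡ h′ x) → (∀ x → f x ≡ f′ x) → RatioUp< h f z → RatioUp< h′ f′ z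
RatioUp<-cong {z = z} h≗ f≗ p rewrite sym (h≗ (2 + z)) | sym (h≗ (3 + z)) | sym (f≗ (2 + z)) | sym (f≗ (3 + z)) = p

RatioUp-cancel : ∀ h f g z → 0 < g (2 + z) → 0 < g (3 + z) → RatioUp (h ⊗ g) (f ⊗ g) z → RatioUp h f z
RatioUp-cancel h f g z p₂ p₃ le = *-cancelʳ-≤ _ _ (g (2 + z) * g (3 + z)) {{>-nonZero (*-mono-< p₂ p₃)}} (begin
  f (2 + z) * h (3 + z) * (g (2 + z) * g (3 + z))  ≡⟨ interchange (f (2 + z)) _ _ _ ⟩
  f (2 + z) * g (2 + z) * (h (3 + z) * g (3 + z))  ≤⟨ le ⟩
  f (3 + z) * g (3 + z) * (h (2 + z) * g (2 + z))  ≡⟨ interchange (f (3 + z)) (g (3 + z)) _ _ ⟩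
  f (3 + z) * h (2 + z) * (g (3 + z) * g (2 + z))  ≡⟨ cong (f (3 + z) * h (2 + z) *_) (*-comm (g (3 + z)) _) ⟩
  f (3 + z) * h (2 + z) * (g (2 + z) * g (3 + z))  ∎)
  where open ≤-Reasoning

private
  step< : ∀ z → suc z * (3 + z) < (2 + z) * (2 + z)
  step< z = ≤-reflexive (lem z)
    where
    lem : ∀ z → suc (suc z * (3 + z)) ≡ (2 + z) * (2 + z)
    lem = solve-∀

path-up : ∀ p z → RatioUp (power p) (pathPoly p) z
path-up p z = begin
  suc z ^ p * (3 + z) ^ p      ≡⟨ ^-distribʳ-* (suc z) (3 + z) p ⟨
  (suc z * (3 + z)) ^ p        ≤⟨ ^-monoˡ-≤ p (<⇒≤ (step< z)) ⟩
  ((2 + z) * (2 + z)) ^ p      ≡⟨ ^-distribʳ-* (2 + z) (2 + z) p ⟩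
  (2 + z) ^ p * (2 + z) ^ p    ∎
  where open ≤-Reasoning

path-up< : ∀ p z → RatioUp< (power (suc p)) (pathPoly (suc p)) z
path-up< p z = begin-strict
  suc z ^ suc p * (3 + z) ^ suc p      ≡⟨ ^-distribʳ-* (suc z) (3 + z) (suc p) ⟨
  (suc z * (3 + z)) ^ suc p            <⟨ ^-monoˡ-< (suc p) (step< z) ⟩
  ((2 + z) * (2 + z)) ^ suc p          ≡⟨ ^-distribʳ-* (2 + z) (2 + z) (suc p) ⟩
  (2 + z) ^ suc p * (2 + z) ^ suc p    ∎
  where open ≤-Reasoning

private
  common : ℕ → ℕ
  common x = x * (x * x) * (x ∸ 1)

  cycle-h : ∀ j x → (base j ⊗ common) x ≡ (power (3 + j) ⊗ pathPoly 2) x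
  cycle-h j x = lem x (x ∸ 1) (x ^ j)
    where
    lem : ∀ x y p → p * y * (x * (x * x) * y) ≡ x * (x * (x * p)) * (y * (y * 1))
    lem = solve-∀

  cycle-f : ∀ j x → (openWalks (2 + j) ⊗ common) x ≡ (power 2 ⊗ cyclePoly (2 + j)) x
  cycle-f j x = lem x (x ∸ 1) (openWalks (2 + j) x)
    where
    lem : ∀ x y b → b * (x * (x * x) * y) ≡ x * (x * 1) * (x * y * b)
    lem = solve-∀

-- Each cycle alone makes up for both factors 1 - 1/x of the star: c_m(x)/x^m over (1 - 1/x)^2 is
-- nondecreasing, m = j + 3. Multiplication by `common` on both sides brings the inequality for b_k
-- into this shape.
cycle-up² : ∀ j z → RatioUp (power (3 + j) ⊗ pathPoly 2) (power 2 ⊗ cyclePoly (2 + j)) z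
cycle-up² j z = RatioUp-cong {z = z} (cycle-h j) (cycle-f j)
  (⊗-mono (base j) (openWalks (2 + j)) common common z (openWalks-up j z) (≤-reflexive (*-comm (common (2 + z)) _)))

cycle-up²< : ∀ j z → RatioUp< (power (3 + j) ⊗ pathPoly 2) (power 2 ⊗ cyclePoly (2 + j)) (suc z)
cycle-up²< j z = RatioUp<-cong {z = suc z} (cycle-h j) (cycle-f j)
  (⊗-mono-< (base j) (openWalks (2 + j)) common common (suc z) (openWalks-up< j z)
    (≤-reflexive (*-comm (common (3 + z)) (common (4 + z)))) (s≤s z≤n))

-- Multiply `cycle-up²` by the nondecreasing (1 - 1/x)^2 and cancel.
cycle-up : ∀ j z → RatioUp (power (3 + j)) (cyclePoly (2 + j)) z
cycle-up j z = RatioUp-cancel (power (3 + j)) (cyclePoly (2 + j)) (power 2 ⊗ pathPoly 2) z (s≤s z≤n) (s≤s z≤n)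
  (RatioUp-cong {z = z} (λ x → lem (x ^ (3 + j)) (x ^ 2) ((x ∸ 1) ^ 2)) (λ x → lem₂ (cyclePoly (2 + j) x) (x ^ 2) ((x ∸ 1) ^ 2))
    (⊗-mono (power (3 + j) ⊗ pathPoly 2) (power 2 ⊗ cyclePoly (2 + j)) (power 2) (pathPoly 2) z
       (cycle-up² j z) (path-up 2 z)))
  where
  lem : ∀ a b c → a * c * b ≡ a * (b * c)
  lem = solve-∀
  lem₂ : ∀ a b c → b * a * c ≡ a * (b * c)
  lem₂ = solve-∀

cyclesPoly : List ℕ → ℕ → ℕ
cyclesPoly js x = product (map (λ j → cyclePoly (2 + j) x) js)

cyclesSize : List ℕ → ℕ
cyclesSize js = sum (map (3 +_) js)

cycles-up : ∀ js z → RatioUp (power (cyclesSize js)) (cyclesPoly js) z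
cycles-up []       z = ≤-refl
cycles-up (j ∷ js) z = RatioUp-cong {f = cyclesPoly (j ∷ js)} {z = z} (λ x → sym (^-distribˡ-+-* x (3 + j) (cyclesSize js))) (λ _ → refl)
  (⊗-mono (power (3 + j)) (cyclePoly (2 + j)) (power (cyclesSize js)) (cyclesPoly js) z (cycle-up j z) (cycles-up js z))

-- The larger side of the strict inequality from x = z+3 to z+4 cannot be 0.
openWalks-pos : ∀ j z → 0 < openWalks (2 + j) (4 + z)
openWalks-pos j z = n≢0⇒n>0 λ eq → contradiction
  (subst (λ b → openWalks (2 + j) (3 + z) * base j (4 + z) < b * base j (3 + z)) eq (openWalks-up< j z)) λ ()

cyclesPoly-pos : ∀ js z → 0 < cyclesPoly js (4 + z)
cyclesPoly-pos []       z = s≤s z≤n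
cyclesPoly-pos (j ∷ js) z = *-mono-< (*-mono-< {0} {(4 + z) * (3 + z)} (s≤s z≤n) (openWalks-pos j z)) (cyclesPoly-pos js z)

-- The chromatic polynomial, up to a power of x, of a graph with maximum degree at most 2 whose
-- cycles have lengths 3 + j for j in js and which has p further edges.
factored : ℕ → List ℕ → ℕ → ℕ
factored p js x = pathPoly p x * cyclesPoly js x

factoredSize : ℕ → List ℕ → ℕ
factoredSize p js = p + cyclesSize js

factored-up-weak : ∀ p js z → RatioUp (power (factoredSize p js)) (factored p js) z
factored-up-weak p js z = RatioUp-cong {f = factored p js} {z = z} (λ x → sym (^-distribˡ-+-* x p (cyclesSize js))) (λ _ → refl)
  (⊗-mono (power p) (pathPoly p) (power (cyclesSize js)) (cyclesPoly js) z (path-up p z) (cycles-up js z))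

private
  twoPaths-h : ∀ p x → (power p ⊗ (power 2 ⊗ pathPoly 2)) x ≡ (power (factoredSize (2 + p) []) ⊗ pathPoly 2) x
  twoPaths-h p x = trans (lem x (x ^ p) _) (cong (λ e → x ^ e * (x ∸ 1) ^ 2) (sym (+-identityʳ (2 + p))))
    where
    lem : ∀ x p b → p * (x * (x * 1) * b) ≡ x * (x * p) * b
    lem = solve-∀

  twoPaths-f : ∀ p x → (pathPoly p ⊗ (power 2 ⊗ pathPoly 2)) x ≡ (power 2 ⊗ factored (2 + p) []) x
  twoPaths-f p x = lem (x ∸ 1) ((x ∸ 1) ^ p) (x ^ 2)
    where
    lem : ∀ y p b → p * (b * (y * (y * 1))) ≡ b * (y * (y * p) * 1)
    lem = solve-∀

  withCycle-h : ∀ p j js x →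
    ((power (3 + j) ⊗ pathPoly 2) ⊗ power (factoredSize p js)) x ≡ (power (factoredSize p (j ∷ js)) ⊗ pathPoly 2) x
  withCycle-h p j js x = trans (trans (lem (x ^ (3 + j)) ((x ∸ 1) ^ 2) (x ^ factoredSize p js)) (cong (_* (x ∸ 1) ^ 2) (sym (^-distribˡ-+-* x (3 + j) (factoredSize p js)))))
    (cong (λ e → x ^ e * (x ∸ 1) ^ 2) (rotate (3 + j) p (cyclesSize js)))
    where
    lem : ∀ a b c → a * b * c ≡ a * c * b
    lem = solve-∀
    rotate : ∀ a b c → a + (b + c) ≡ b + (a + c)
    rotate = solve-∀

  withCycle-f : ∀ p j js x →
    ((power 2 ⊗ cyclePoly (2 + j)) ⊗ factored p js) x ≡ (power 2 ⊗ factored p (j ∷ js)) x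
  withCycle-f p j js x = lem (x ^ 2) (cyclePoly (2 + j) x) (pathPoly p x) (cyclesPoly js x)
    where
    lem : ∀ a b c d → a * b * (c * d) ≡ a * (c * (b * d))
    lem = solve-∀

-- The comparison with (1 - 1/x)^2 is charged to one cycle if there is any, otherwise to two of the
-- remaining edges; all other factors are nondecreasing on their own.
factored-up : ∀ p js z → 2 ≤ factoredSize p js →
  RatioUp (power (factoredSize p js) ⊗ pathPoly 2) (power 2 ⊗ factored p js) z
factored-up (suc zero) [] z (s≤s ())
factored-up (suc (suc p)) [] z _ = RatioUp-cong {z = z} (twoPaths-h p) (twoPaths-f p)
  (⊗-mono (power p) (pathPoly p) (power 2 ⊗ pathPoly 2) (power 2 ⊗ pathPoly 2) z (path-up p z)
    (≤-reflexive (*-comm ((power 2 ⊗ pathPoly 2) (2 + z)) _)))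
factored-up p (j ∷ js) z _ = RatioUp-cong {z = z} (withCycle-h p j js) (withCycle-f p j js)
  (⊗-mono (power (3 + j) ⊗ pathPoly 2) (power 2 ⊗ cyclePoly (2 + j)) (power (factoredSize p js)) (factored p js) z
    (cycle-up² j z) (factored-up-weak p js z))

-- Strictness comes from the charged cycle, or without cycles from a third edge; positivity of the
-- other factors at x = z+4 preserves it.
factored-up< : ∀ p js z → 3 ≤ factoredSize p js →
  RatioUp< (power (factoredSize p js) ⊗ pathPoly 2) (power 2 ⊗ factored p js) (suc z)
factored-up< (suc zero) [] z (s≤s ())
factored-up< (suc (suc zero)) [] z (s≤s (s≤s ()))
factored-up< (suc (suc (suc p))) [] z _ = RatioUp<-cong {z = suc z} (twoPaths-h (suc p)) (twoPaths-f (suc p))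
  (⊗-mono-< (power (suc p)) (pathPoly (suc p)) (power 2 ⊗ pathPoly 2) (power 2 ⊗ pathPoly 2) (suc z) (path-up< p (suc z))
    (≤-reflexive (*-comm ((power 2 ⊗ pathPoly 2) (3 + z)) ((power 2 ⊗ pathPoly 2) (4 + z)))) (s≤s z≤n))
factored-up< p (j ∷ js) z _ = RatioUp<-cong {z = suc z} (withCycle-h p j js) (withCycle-f p j js)
  (⊗-mono-< (power (3 + j) ⊗ pathPoly 2) (power 2 ⊗ cyclePoly (2 + j)) (power (factoredSize p js)) (factored p js) (suc z)
    (cycle-up²< j z) (factored-up-weak p js (suc z))
    (*-mono-< (*-mono-< (m^n>0 (3 + z) p) (cyclesPoly-pos js z)) (m^n>0 (3 + z) (factoredSize p js))))

-- Set partitions as restricted growth functions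

𝟙 : Bool → ℕ
𝟙 true  = 1
𝟙 false = 0

∑-const : ∀ n c → ∑ {n} (λ _ → c) ≡ n * c
∑-const zero    c = refl
∑-const (suc n) c = cong (c +_) (∑-const n c)

∑-*ˡ : ∀ {n} c (f : Fin n → ℕ) → ∑ (λ i → c * f i) ≡ c * ∑ f
∑-*ˡ c f = sym (*-distribˡ-∑ c f)

∑-*ʳ : ∀ {n} c (f : Fin n → ℕ) → ∑ (λ i → f i * c) ≡ ∑ f * c
∑-*ʳ c f = sym (*-distribʳ-∑ c f)

==ᶠ-true : ∀ {k} {a b : Fin k} → a ≡ b → (a ==ᶠ b) ≡ true
==ᶠ-true {a = a} {b} a≡b with a ≟ᶠ b
... | yes _   = refl
... | no  a≢b = contradiction a≡b a≢b

==ᶠ-false : ∀ {k} {a b : Fin k} → a ≢ b → (a ==ᶠ b) ≡ false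
==ᶠ-false {a = a} {b} a≢b with a ≟ᶠ b
... | yes a≡b = contradiction a≡b a≢b
... | no  _   = refl

==ᶠ-true⁻¹ : ∀ {k} {a b : Fin k} → (a ==ᶠ b) ≡ true → a ≡ b
==ᶠ-true⁻¹ {a = a} {b} eq with a ≟ᶠ b | eq
... | yes a≡b | _ = a≡b

==ᶠ-cong : ∀ {k l} {a b : Fin k} {c d : Fin l} → (a ≡ b → c ≡ d) → (c ≡ d → a ≡ b) → (a ==ᶠ b) ≡ (c ==ᶠ d)
==ᶠ-cong {a = a} {b} f g with a ≟ᶠ b
... | yes a≡b = sym (==ᶠ-true (f a≡b))
... | no  a≢b = sym (==ᶠ-false (a≢b ∘ g))

∑-δ : ∀ {n} (i : Fin n) (f : Fin n → ℕ) → ∑ (λ j → 𝟙 (j ==ᶠ i) * f j) ≡ f i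
∑-δ {suc n} fzero f = begin
  f fzero + 0 + ∑ (λ j → 𝟙 (fsuc j ==ᶠ fzero) * f (fsuc j))  ≡⟨ cong (f fzero + 0 +_) (trans (∑-const n 0) (*-zeroʳ n)) ⟩
  f fzero + 0 + 0                                             ≡⟨ trans (+-identityʳ _) (+-identityʳ _) ⟩
  f fzero                                                     ∎
  where open ≡-Reasoning
∑-δ (fsuc i) f = trans
  (∑-cong (λ j → cong (λ b → 𝟙 b * f (fsuc j)) (==ᶠ-cong {a = fsuc j} {fsuc i} {j} {i} fsuc-injective (cong fsuc))))
  (∑-δ i (f ∘ fsuc))

∑-δ₁ : ∀ {n} (i : Fin n) → ∑ (λ j → 𝟙 (j ==ᶠ i)) ≡ 1
∑-δ₁ {n} i = trans (∑-cong {n} (λ j → sym (*-identityʳ (𝟙 (j ==ᶠ i))))) (∑-δ i (λ _ → 1))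

∑-allFin : ∀ n (f : Fin n → ℕ) → sum (map f (allFin n)) ≡ ∑ f
∑-allFin n f = trans (cong sum (map-tabulate (λ i → i) f)) (sum-tabulate n f)
  where
  sum-tabulate : ∀ n (f : Fin n → ℕ) → sum (tabulate f) ≡ ∑ f
  sum-tabulate zero    f = refl
  sum-tabulate (suc n) f = cong (f fzero +_) (sum-tabulate n (f ∘ fsuc))

∑maps : ∀ n x → ((Fin n → Fin x) → ℕ) → ℕ
∑maps zero    x F = F (λ ())
∑maps (suc n) x F = ∑maps n x (λ c → ∑ (λ a → F (a ∷ᶠ c)))

∑maps-cong : ∀ n {x} {F F′ : (Fin n → Fin x) → ℕ} → (∀ c → F c ≡ F′ c) → ∑maps n x F ≡ ∑maps n x F′
∑maps-cong zero    F≗ = F≗ _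
∑maps-cong (suc n) F≗ = ∑maps-cong n (λ c → ∑-cong (λ a → F≗ (a ∷ᶠ c)))

-- Point 0 either opens a block, which gets number 0, or joins a block of the later points. Every
-- set partition has exactly one such code, so counting codes requires no quotient.
data Part : ℕ → ℕ → Set where
  []  : Part 0 0
  new : ∀ {n k} → Part n k → Part (suc n) (suc k)
  old : ∀ {n k} → Part n k → Fin k → Part (suc n) k

col : ∀ {n k} → Part n k → Fin n → Fin k
col (new π)   fzero    = fzero
col (new π)   (fsuc i) = fsuc (col π i)
col (old π j) fzero    = j
col (old π j) (fsuc i) = col π i

parts : ∀ n k → List (Part n k)
parts zero    zero    = [] ∷ []
parts zero    (suc k) = []
parts (suc n) zero    = []
parts (suc n) (suc k) = map new (parts n k) ++ cartesianProductWith old (parts n (suc k)) (allFin (suc k))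

∑parts : ∀ n k → (Part n k → ℕ) → ℕ
∑parts n k F = sum (map F (parts n k))

sum-map-+ : ∀ {A : Set} (f g : A → ℕ) xs → sum (map (λ x → f x + g x) xs) ≡ sum (map f xs) + sum (map g xs)
sum-map-+ f g []       = refl
sum-map-+ f g (x ∷ xs) = trans (cong (f x + g x +_) (sum-map-+ f g xs)) (lem (f x) (g x) (sum (map f xs)) _)
  where
  lem : ∀ a b c d → a + b + (c + d) ≡ a + c + (b + d)
  lem = solve-∀

sum-map-* : ∀ {A : Set} c (f : A → ℕ) xs → sum (map (λ x → c * f x) xs) ≡ c * sum (map f xs)
sum-map-* c f []       = sym (*-zeroʳ c)
sum-map-* c f (x ∷ xs) = trans (cong (c * f x +_) (sum-map-* c f xs)) (sym (*-distribˡ-+ c (f x) _))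

sum-map-× : ∀ {A B C : Set} (g : A → B → C) (F : C → ℕ) xs ys →
  sum (map F (cartesianProductWith g xs ys)) ≡ sum (map (λ x → sum (map (F ∘ g x) ys)) xs)
sum-map-× g F []       ys = refl
sum-map-× g F (x ∷ xs) ys = begin
  sum (map F (map (g x) ys ++ cartesianProductWith g xs ys))
    ≡⟨ cong sum (map-++ F (map (g x) ys) _) ⟩
  sum (map F (map (g x) ys) ++ map F (cartesianProductWith g xs ys))
    ≡⟨ sum-++ (map F (map (g x) ys)) _ ⟩
  sum (map F (map (g x) ys)) + sum (map F (cartesianProductWith g xs ys))
    ≡⟨ cong₂ _+_ (cong sum (sym (map-∘ ys))) (sum-map-× g F xs ys) ⟩
  sum (map (F ∘ g x) ys) + sum (map (λ x → sum (map (F ∘ g x) ys)) xs) ∎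
  where open ≡-Reasoning

∑parts-suc : ∀ n k (F : Part (suc n) (suc k) → ℕ) →
  ∑parts (suc n) (suc k) F ≡ ∑parts n k (F ∘ new) + ∑parts n (suc k) (λ π → ∑ (λ j → F (old π j)))
∑parts-suc n k F = begin
  sum (map F (map new (parts n k) ++ cartesianProductWith old (parts n (suc k)) (allFin (suc k))))
    ≡⟨ trans (cong sum (map-++ F (map new (parts n k)) _)) (sum-++ (map F (map new (parts n k))) _) ⟩
  sum (map F (map new (parts n k))) + sum (map F (cartesianProductWith old (parts n (suc k)) (allFin (suc k))))
    ≡⟨ cong₂ _+_ (cong sum (sym (map-∘ (parts n k)))) (sum-map-× old F (parts n (suc k)) (allFin (suc k))) ⟩
  ∑parts n k (F ∘ new) + ∑parts n (suc k) (λ π → sum (map (F ∘ old π) (allFin (suc k))))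
    ≡⟨ cong (∑parts n k (F ∘ new) +_) (cong sum (map-cong (λ π → ∑-allFin (suc k) (F ∘ old π)) (parts n (suc k)))) ⟩
  ∑parts n k (F ∘ new) + ∑parts n (suc k) (λ π → ∑ (λ j → F (old π j))) ∎
  where open ≡-Reasoning

∑parts-empty : ∀ {n k} (F : Part n k → ℕ) → n < k → ∑parts n k F ≡ 0
∑parts-empty {zero}  {suc k} F _         = refl
∑parts-empty {suc n} {suc k} F (s≤s n<k) = trans (∑parts-suc n k F)
  (cong₂ _+_ (∑parts-empty (F ∘ new) n<k) (∑parts-empty _ (m≤n⇒m≤1+n n<k)))

∑≤ : ℕ → (ℕ → ℕ) → ℕ
∑≤ zero    f = f 0
∑≤ (suc m) f = ∑≤ m f + f (suc m)

∑≤-cong : ∀ m {f g} → (∀ k → f k ≡ g k) → ∑≤ m f ≡ ∑≤ m g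
∑≤-cong zero    f≗g = f≗g 0
∑≤-cong (suc m) f≗g = cong₂ _+_ (∑≤-cong m f≗g) (f≗g (suc m))

∑≤-+ : ∀ m f g → ∑≤ m (λ k → f k + g k) ≡ ∑≤ m f + ∑≤ m g
∑≤-+ zero    f g = refl
∑≤-+ (suc m) f g = trans (cong (_+ (f (suc m) + g (suc m))) (∑≤-+ m f g)) (lem (∑≤ m f) (∑≤ m g) _ _)
  where
  lem : ∀ a b c d → a + b + (c + d) ≡ a + c + (b + d)
  lem = solve-∀

∑≤-shift : ∀ m f → ∑≤ (suc m) f ≡ f 0 + ∑≤ m (f ∘ suc)
∑≤-shift zero    f = refl
∑≤-shift (suc m) f = trans (cong (_+ f (suc (suc m))) (∑≤-shift m f)) (+-assoc (f 0) _ _)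

-- A map c : Fin n → Fin x is the same thing as a set partition of Fin n together with an
-- injection of its blocks into the colours.
record Coded {n x} (c : Fin n → Fin x) : Set where
  field
    {blocks} : ℕ
    part     : Part n blocks
    embed    : Fin blocks → Fin x
    inj      : ∀ {i j} → embed i ≡ embed j → i ≡ j
    factors  : ∀ i → c i ≡ embed (col part i)
open Coded

-- The decision is an argument, so that `∑-extend` can treat its two outcomes separately.
extendBy : ∀ {n x} {c : Fin (suc n) → Fin x} (K : Coded (c ∘ fsuc)) → Dec (∃ λ j → embed K j ≡ c fzero) → Coded c
extendBy K (yes (j , eq)) = record
  { part = old (part K) j ; embed = embed K ; inj = inj K
  ; factors = λ { fzero → sym eq ; (fsuc i) → factors K i } }
extendBy {c = c} K (no fresh) = record
  { part = new (part K) ; embed = c fzero ∷ᶠ embed K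
  ; inj = λ { {fzero} {fzero} _ → refl
            ; {fzero} {fsuc j} eq → contradiction (j , sym eq) fresh
            ; {fsuc i} {fzero} eq → contradiction (i , eq) fresh
            ; {fsuc i} {fsuc j} eq → cong fsuc (inj K eq) }
  ; factors = λ { fzero → refl ; (fsuc i) → factors K i } }

extend : ∀ {n x} {c : Fin (suc n) → Fin x} → Coded (c ∘ fsuc) → Coded c
extend {c = c} K = extendBy K (any? (λ j → embed K j ≟ᶠ c fzero))

code : ∀ n {x} (c : Fin n → Fin x) → Coded c
code zero    c = record { part = [] ; embed = λ () ; inj = λ { {()} } ; factors = λ () }
code (suc n) c = extend (code n (c ∘ fsuc))

-- Among the x colours for the new point, each block accounts for one, which makes the point join
-- that block; the others open a new block. To avoid subtraction, the value of a new block is added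
-- once for every colour already in use.
∑-extend : ∀ {n x} {c : Fin n → Fin x} (K : Coded c) (F : ∀ {k} → Part (suc n) k → ℕ) →
  ∑ (λ a → F (part (extend {c = a ∷ᶠ c} K))) ≡ (x ∸ blocks K) * F (new (part K)) + ∑ (λ j → F (old (part K) j))
∑-extend {n} {x} {c} K F = +-cancelʳ-≡ (blocks K * fresh) _ _ (begin
  ∑ value + blocks K * fresh
    ≡⟨ cong (∑ value +_) (trans (sym (∑-const (blocks K) fresh)) (sym (∑-hit (λ _ → fresh)))) ⟩
  ∑ value + ∑ (λ a → ∑ (λ j → hit a j * fresh))
    ≡⟨ sym (∑-+ value _) ⟩
  ∑ (λ a → value a + ∑ (λ j → hit a j * fresh))
    ≡⟨ ∑-cong (λ a → pointwise a (any? (λ j → embed K j ≟ᶠ a))) ⟩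
  ∑ (λ a → fresh + ∑ (λ j → hit a j * reuse j))
    ≡⟨ trans (∑-+ {x} (λ _ → fresh) _) (cong₂ _+_ (∑-const x fresh) (∑-hit reuse)) ⟩
  x * fresh + ∑ reuse
    ≡⟨ cong (λ a → a * fresh + ∑ reuse) (sym (m∸n+n≡m (injective⇒≤ (inj K)))) ⟩
  (x ∸ blocks K + blocks K) * fresh + ∑ reuse
    ≡⟨ lem (x ∸ blocks K) (blocks K) fresh _ ⟩
  (x ∸ blocks K) * fresh + ∑ reuse + blocks K * fresh ∎)
  where
  open ≡-Reasoning
  lem : ∀ a b f s → (a + b) * f + s ≡ a * f + s + b * f
  lem = solve-∀
  fresh = F (new (part K))
  reuse = λ j → F (old (part K) j)
  value : Fin x → ℕ
  value a = F (part (extend {c = a ∷ᶠ c} K))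
  hit : Fin x → Fin (blocks K) → ℕ
  hit a j = 𝟙 (a ==ᶠ embed K j)
  ∑-hit : ∀ (g : Fin (blocks K) → ℕ) → ∑ (λ a → ∑ (λ j → hit a j * g j)) ≡ ∑ g
  ∑-hit g = trans (∑-comm {x} {blocks K} (λ a j → hit a j * g j)) (∑-cong (λ j →
    trans (∑-*ʳ {x} (g j) (λ a → hit a j)) (trans (cong (_* g j) (∑-δ₁ (embed K j))) (+-identityʳ _))))
  pointwise : ∀ a (d : Dec (∃ λ j → embed K j ≡ a)) →
    F (part (extendBy {c = a ∷ᶠ c} K d)) + ∑ (λ j → hit a j * fresh) ≡ fresh + ∑ (λ j → hit a j * reuse j)
  pointwise a (yes (i , refl)) = trans (+-comm (reuse i) _)
    (cong₂ _+_ (trans (∑-cong (λ j → cong (λ b → 𝟙 b * fresh) (same j))) (∑-δ i (λ _ → fresh)))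
               (sym (trans (∑-cong (λ j → cong (λ b → 𝟙 b * reuse j) (same j))) (∑-δ i reuse))))
    where
    same : ∀ j → (embed K i ==ᶠ embed K j) ≡ (j ==ᶠ i)
    same j = ==ᶠ-cong (sym ∘ inj K) (sym ∘ cong (embed K))
  pointwise a (no fresh-a) = cong (fresh +_) (∑-cong λ j → trans (miss j fresh) (sym (miss j (reuse j))))
    where
    miss : ∀ j g → hit a j * g ≡ 0
    miss j g = cong (λ b → 𝟙 b * g) (==ᶠ-false λ eq → fresh-a (j , sym eq))

-- A partition into k blocks is the code of x↓k maps, one for each choice of distinct colours for
-- its blocks. In the induction `∂F` collects the possibilities for point 0.
∑maps-code : ∀ n x (F : ∀ {k} → Part n k → ℕ) →
  ∑maps n x (λ c → F (part (code n c))) ≡ ∑≤ n (λ k → x ↓ k * ∑parts n k F)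
∑maps-code zero    x F = sym (trans (+-identityʳ _) (+-identityʳ _))
∑maps-code (suc n) x F = begin
  ∑maps n x (λ c → ∑ (λ a → F (part (extend {c = a ∷ᶠ c} (code n c)))))
    ≡⟨ ∑maps-cong n (λ c → ∑-extend (code n c) F) ⟩
  ∑maps n x (λ c → ∂F (part (code n c)))
    ≡⟨ ∑maps-code n x ∂F ⟩
  ∑≤ n (λ k → x ↓ k * ∑parts n k ∂F)
    ≡⟨ ∑≤-cong n split ⟩
  ∑≤ n (λ k → opened k + joined k)
    ≡⟨ ∑≤-+ n opened joined ⟩
  ∑≤ n opened + ∑≤ n joined
    -- Joining keeps the number of blocks while opening raises it, so `joined` is shifted by one.
    -- Its end terms vanish: n points have no n+1 blocks, and with k = 0 there is no block to join.
    ≡⟨ cong (∑≤ n opened +_) (trans (sym (+-identityʳ _)) (trans (cong (∑≤ n joined +_) (sym joined-last)) (trans (∑≤-shift n joined) (cong (_+ ∑≤ n (joined ∘ suc)) joined-zero)))) ⟩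
  ∑≤ n opened + ∑≤ n (joined ∘ suc)
    ≡⟨ sym (∑≤-+ n opened (joined ∘ suc)) ⟩
  ∑≤ n (λ k → opened k + joined (suc k))
    ≡⟨ ∑≤-cong n (λ k → trans (sym (*-distribˡ-+ (x ↓ suc k) _ _)) (cong (x ↓ suc k *_) (sym (∑parts-suc n k F)))) ⟩
  ∑≤ n (λ k → x ↓ suc k * ∑parts (suc n) (suc k) F)
    ≡⟨ sym (∑≤-shift n (λ k → x ↓ k * ∑parts (suc n) k F)) ⟩
  ∑≤ (suc n) (λ k → x ↓ k * ∑parts (suc n) k F) ∎
  where
  open ≡-Reasoning
  ∂F : ∀ {k} → Part n k → ℕ
  ∂F {k} π = (x ∸ k) * F (new π) + ∑ (λ j → F (old π j))
  opened joined : ℕ → ℕ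
  opened k = x ↓ suc k * ∑parts n k (F ∘ new)
  joined k = x ↓ k * ∑parts n k (λ π → ∑ (λ j → F (old π j)))
  split : ∀ k → x ↓ k * ∑parts n k ∂F ≡ opened k + joined k
  split k = begin
    x ↓ k * ∑parts n k ∂F
      ≡⟨ cong (x ↓ k *_) (trans (sum-map-+ _ _ (parts n k)) (cong (_+ _) (sum-map-* (x ∸ k) (F ∘ new) (parts n k)))) ⟩
    x ↓ k * ((x ∸ k) * ∑parts n k (F ∘ new) + ∑parts n k (λ π → ∑ (λ j → F (old π j))))
      ≡⟨ arith (x ↓ k) (x ∸ k) _ _ ⟩
    (x ∸ k) * x ↓ k * ∑parts n k (F ∘ new) + joined k
      ≡⟨ cong (λ a → a * ∑parts n k (F ∘ new) + joined k) (sym (↓-∸ x k)) ⟩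
    opened k + joined k ∎
    where
    arith : ∀ p d a b → p * (d * a + b) ≡ d * p * a + p * b
    arith = solve-∀
  joined-last : joined (suc n) ≡ 0
  joined-last = trans (cong (x ↓ suc n *_) (∑parts-empty {n} {suc n} _ ≤-refl)) (*-zeroʳ (x ↓ suc n))
  joined-zero : joined 0 ≡ 0
  joined-zero = trans (+-identityʳ _) (zeros (parts n 0))
    where
    zeros : ∀ {A : Set} (xs : List A) → sum (map (λ _ → 0) xs) ≡ 0
    zeros []       = refl
    zeros (x ∷ xs) = zeros xs

-- Equivalence classes of colourings as proper partitions

SameKernel : ∀ {n k l} → (Fin n → Fin k) → (Fin n → Fin l) → Set
SameKernel c d = ∀ i j → (c i ==ᶠ c j) ≡ (d i ==ᶠ d j)

code-kernel : ∀ {n x} {c : Fin n → Fin x} (K : Coded c) → SameKernel c (col (part K))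
code-kernel K i j = ==ᶠ-cong
  (λ eq → inj K (trans (sym (factors K i)) (trans eq (factors K j))))
  (λ eq → trans (factors K i) (trans (cong (embed K) eq) (sym (factors K j))))

all-cong : ∀ {A : Set} {p q : A → Bool} xs → (∀ x → p x ≡ q x) → all p xs ≡ all q xs
all-cong xs p≗q = cong and (map-cong p≗q xs)

isProper-kernel : ∀ {n k l} (G : Graph n) {c : Fin n → Fin k} {d : Fin n → Fin l} → SameKernel c d → isProper G c ≡ isProper G d
isProper-kernel {n} G same = all-cong (allFin n) λ i → all-cong (allFin n) λ j →
  cong (λ b → not (adj G i j ∧ b)) (same i j)

chromatic : ∀ {n} → Graph n → ℕ → ℕ
chromatic {n} G x = ∑maps n x (λ c → 𝟙 (isProper G c))

properParts : ∀ {n} → Graph n → ℕ → ℕ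
properParts {n} G k = ∑parts n k (λ π → 𝟙 (isProper G (col π)))

chromatic-↓ : ∀ {n} (G : Graph n) x → chromatic G x ≡ ∑≤ n (λ k → x ↓ k * properParts G k)
chromatic-↓ {n} G x = trans
  (∑maps-cong n (λ c → cong 𝟙 (isProper-kernel G (code-kernel (code n c)))))
  (∑maps-code n x (λ π → 𝟙 (isProper G (col π))))

lookup-AllPairs : ∀ {A : Set} {R : A → A → Set} {xs : List A} → Symmetric R → AllPairs R xs →
  ∀ i j → i ≢ j → R (lookup xs i) (lookup xs j)
lookup-AllPairs sym-R (px ∷ _)   fzero    fzero    i≢j = contradiction refl i≢j
lookup-AllPairs sym-R (px ∷ _)   fzero    (fsuc j) _   = All.lookup px (∈-lookup j)
lookup-AllPairs sym-R (px ∷ _)   (fsuc i) fzero    _   = sym-R (All.lookup px (∈-lookup i))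
lookup-AllPairs sym-R (_ ∷ pxs)  (fsuc i) (fsuc j) i≢j = lookup-AllPairs sym-R pxs i j (i≢j ∘ cong fsuc)

module _ {A : Set} {_≈_ : A → A → Set} (_≈?_ : Decidable _≈_)
         (≈-refl : Reflexive _≈_) (≈-sym : Symmetric _≈_) (≈-trans : Transitive _≈_) where

  length-mono-≈ : ∀ {xs ys} → AllPairs (λ x y → ¬ x ≈ y) xs → (∀ {x} → x ∈ xs → Any (x ≈_) ys) → length xs ≤ length ys
  length-mono-≈ {xs} {ys} distinct cover = injective⇒≤ {f = target} target-injective
    where
    covered : ∀ i → Any (lookup xs i ≈_) ys
    covered i = cover (∈-lookup i)
    target : Fin (length xs) → Fin (length ys)
    target i = Any.index (covered i)
    target-injective : ∀ {i j} → target i ≡ target j → i ≡ j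
    target-injective {i} {j} eq with i ≟ᶠ j
    ... | yes i≡j = i≡j
    ... | no  i≢j = contradiction
      (≈-trans (Any.lookup-index (covered i))
               (subst (λ t → lookup ys t ≈ lookup xs j) (sym eq) (≈-sym (Any.lookup-index (covered j)))))
      (lookup-AllPairs {R = λ x y → ¬ x ≈ y} (λ x≉y y≈x → x≉y (≈-sym y≈x)) distinct i j i≢j)

  deduplicate-distinct : ∀ xs → AllPairs (λ x y → ¬ x ≈ y) (deduplicate _≈?_ xs)
  deduplicate-distinct []       = []
  deduplicate-distinct (x ∷ xs) =
    all-filter (¬? ∘ (x ≈?_)) (deduplicate _≈?_ xs) ∷ AllPairs.filter⁺ (¬? ∘ (x ≈?_)) (deduplicate-distinct xs)

  length-deduplicate : ∀ xs ys → AllPairs (λ x y → ¬ x ≈ y) ys →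
    (∀ {x} → x ∈ xs → Any (x ≈_) ys) → (∀ {y} → y ∈ ys → Any (y ≈_) xs) →
    length (deduplicate _≈?_ xs) ≡ length ys
  length-deduplicate xs ys distinct xs⊆ys ys⊆xs = ≤-antisym
    (length-mono-≈ (deduplicate-distinct xs) (λ x∈ → xs⊆ys (Any.deduplicate⁻ _≈?_ x∈)))
    (length-mono-≈ distinct (λ y∈ → Any.deduplicate⁺ _≈?_ (λ x≈y z≈y → ≈-trans z≈y (≈-sym x≈y)) (ys⊆xs y∈)))

length-filter-T : ∀ {A : Set} (p : A → Bool) xs → length (filter (T? ∘ p) xs) ≡ sum (map (𝟙 ∘ p) xs)
length-filter-T p [] = refl
length-filter-T p (x ∷ xs) with p x
... | true  = cong suc (length-filter-T p xs)
... | false = length-filter-T p xs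

all-allFin⁺ : ∀ {n} {p : Fin n → Bool} → (∀ i → T (p i)) → T (all p (allFin n))
all-allFin⁺ {n} {p} h = all⁻ p {xs = allFin n} (All.tabulate (λ {i} _ → h i))

all-allFin⁻ : ∀ {n} {p : Fin n → Bool} → T (all p (allFin n)) → ∀ i → T (p i)
all-allFin⁻ {n} {p} h i = All.lookup (all⁺ p (allFin n) h) (∈-allFin i)

equivColourings⁻ : ∀ {n k} (c d : Fin n → Fin k) → T (equivColourings c d) → SameKernel c d
equivColourings⁻ c d h i j = agree (c i ==ᶠ c j) (d i ==ᶠ d j) (all-allFin⁻ (all-allFin⁻ h i) j)
  where
  agree : ∀ a b → T (not (a xor b)) → a ≡ b
  agree true  true  _ = refl
  agree false false _ = refl

equivColourings⁺ : ∀ {n k} (c d : Fin n → Fin k) → SameKernel c d → T (equivColourings c d)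
equivColourings⁺ c d same = all-allFin⁺ λ i → all-allFin⁺ λ j → agree (c i ==ᶠ c j) (d i ==ᶠ d j) (same i j)
  where
  agree : ∀ a b → a ≡ b → T (not (a xor b))
  agree true  .true  refl = tt
  agree false .false refl = tt

isOnto⁺ : ∀ {n k} {c : Fin n → Fin k} → (∀ a → ∃ λ i → c i ≡ a) → T (isOnto c)
isOnto⁺ {c = c} onto = all-allFin⁺ λ a → any⁺ _ (lose (∈-allFin (proj₁ (onto a))) (fromWitness (proj₂ (onto a))))

isOnto⁻ : ∀ {n k} {c : Fin n → Fin k} → T (isOnto c) → ∀ a → ∃ λ i → c i ≡ a
isOnto⁻ {n} {c = c} h a with find (any⁻ _ (allFin n) (all-allFin⁻ h a))
... | i , _ , eq = i , toWitness eq

col-onto : ∀ {n k} (π : Part n k) a → ∃ λ i → col π i ≡ a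
col-onto (new π)   fzero    = fzero , refl
col-onto (new π)   (fsuc a) with col-onto π a
... | i , refl = fsuc i , refl
col-onto (old π j) a        with col-onto π a
... | i , refl = fsuc i , refl

-- `new` separates point 0 from all later points, while `old` puts it together with one, since every
-- block is inhabited; hence the mixed cases clash. For `old` twice, a later member of the block
-- identifies it.
col-injective : ∀ {n k} (π ρ : Part n k) → SameKernel (col π) (col ρ) → π ≡ ρ
col-injective [] [] _ = refl
col-injective (new π) (new ρ) same =
  cong new (col-injective π ρ λ i j → trans (==ᶠ-cong (cong fsuc) fsuc-injective) (trans (same (fsuc i) (fsuc j)) (==ᶠ-cong fsuc-injective (cong fsuc))))
col-injective (old π j) (old ρ l) same with col-injective π ρ (λ a b → same (fsuc a) (fsuc b)) | col-onto π j
... | refl | i , refl = cong (old π) (sym (==ᶠ-true⁻¹ (trans (sym (same fzero (fsuc i))) (==ᶠ-true {a = col π i} refl))))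
col-injective (new π) (old ρ l) same with col-onto ρ l
... | i , refl with () ← trans (sym (==ᶠ-true {a = col ρ i} refl)) (sym (same fzero (fsuc i)))
col-injective (old π j) (new ρ) same with col-onto π j
... | i , refl with () ← trans (sym (==ᶠ-true {a = col π i} refl)) (same fzero (fsuc i))

∈-parts : ∀ {n k} (π : Part n k) → π ∈ parts n k
∈-parts []                = here refl
∈-parts (new π)           = ∈-++⁺ˡ (∈-map⁺ new (∈-parts π))
∈-parts {suc n} {suc k} (old π j) = ∈-++⁺ʳ (map new (parts n k)) (∈-cartesianProductWith⁺ old (∈-parts π) (∈-allFin j))

parts-unique : ∀ n k → Unique (parts n k)
parts-unique zero    zero    = [] ∷ []
parts-unique zero    (suc k) = []
parts-unique (suc n) zero    = []
parts-unique (suc n) (suc k) = Unique.++⁺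
  (Unique.map⁺ (λ { refl → refl }) (parts-unique n k))
  (Unique.cartesianProductWith⁺ old (λ { refl → refl , refl }) (parts-unique n (suc k)) (Unique.allFin⁺ (suc k)))
  disjoint
  where
  disjoint : ∀ {π} → ¬ (π ∈ map new (parts n k) × π ∈ cartesianProductWith old (parts n (suc k)) (allFin (suc k)))
  disjoint (p , q) with ∈-map⁻ new p | ∈-cartesianProductWith⁻ old (parts n (suc k)) (allFin (suc k)) q
  ... | _ , _ , refl | _ , _ , _ , _ , ()

∈-allMaps : ∀ n {k} (c : Fin n → Fin k) → ∃ λ d → d ∈ allMaps n k × (∀ i → c i ≡ d i)
∈-allMaps zero    c = _ , here refl , λ ()
∈-allMaps (suc n) {k} c with ∈-allMaps n (c ∘ fsuc)
... | d , d∈ , c≗d = (c fzero ∷ᶠ d)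
  , ∈-concatMap⁺ (λ a → map (a ∷ᶠ_) (allMaps n k)) (lose (∈-allFin (c fzero)) (∈-map⁺ (c fzero ∷ᶠ_) d∈))
  , λ { fzero → refl ; (fsuc i) → c≗d i }

S≡properParts : ∀ {n} (G : Graph n) k → S G k ≡ properParts G k
S≡properParts {n} G k = begin
  S G k                                       ≡⟨ length-deduplicate _≈?_ (λ {c} → equivColourings⁺ c c (λ _ _ → refl))
        (λ {c} {d} → ≈-sym {c} {d}) (λ {c} {d} {e} → ≈-trans {c} {d} {e})
        (filter good? (allMaps n k)) (map col (filter proper? (parts n k))) distinct covers covered ⟩
  length (map col (filter proper? (parts n k)))  ≡⟨ length-map col (filter proper? (parts n k)) ⟩
  length (filter proper? (parts n k))            ≡⟨ length-filter-T _ (parts n k) ⟩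
  properParts G k                             ∎
  where
  open ≡-Reasoning
  _≈_ : (c d : Fin n → Fin k) → Set
  c ≈ d = T (equivColourings c d)
  _≈?_ : Decidable _≈_
  c ≈? d = T? (equivColourings c d)
  ≈-sym : Symmetric _≈_
  ≈-sym {c} {d} p = equivColourings⁺ d c (λ i j → sym (equivColourings⁻ c d p i j))
  ≈-trans : Transitive _≈_
  ≈-trans {c} {d} {e} p q = equivColourings⁺ c e (λ i j → trans (equivColourings⁻ c d p i j) (equivColourings⁻ d e q i j))
  proper? = λ (π : Part n k) → T? (isProper G (col π))
  good? = λ (c : Fin n → Fin k) → T? (isProper G c ∧ isOnto c)

  distinct : AllPairs (λ c d → ¬ c ≈ d) (map col (filter proper? (parts n k)))
  distinct = AllPairs.map⁺ (AllPairs.map (λ {π} {ρ} π≢ρ p → π≢ρ (col-injective π ρ (equivColourings⁻ (col π) (col ρ) p)))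
    (AllPairs.filter⁺ proper? (parts-unique n k)))

  -- A surjective map uses all k colours, and preimages of distinct colours lie in distinct blocks.
  onto-blocks : ∀ {c : Fin n → Fin k} (K : Coded c) → (∀ a → ∃ λ i → c i ≡ a) → Coded.blocks K ≡ k
  onto-blocks K onto = ≤-antisym (injective⇒≤ (Coded.inj K))
    (injective⇒≤ {f = λ a → col (Coded.part K) (proj₁ (onto a))} λ {a} {b} eq →
      trans (sym (preimage a)) (trans (cong (Coded.embed K) eq) (preimage b)))
    where
    preimage : ∀ a → Coded.embed K (col (Coded.part K) (proj₁ (onto a))) ≡ a
    preimage a = trans (sym (Coded.factors K (proj₁ (onto a)))) (proj₂ (onto a))

  covers : ∀ {c} → c ∈ filter good? (allMaps n k) → Any (c ≈_) (map col (filter proper? (parts n k)))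
  covers {c} c∈ with Equivalence.to T-∧ (proj₂ (∈-filter⁻ good? {xs = allMaps n k} c∈))
  ... | proper , onto with code n c | onto-blocks (code n c) (isOnto⁻ onto)
  ...   | K | refl = lose (∈-map⁺ col (∈-filter⁺ proper? (∈-parts (Coded.part K)) (subst T (isProper-kernel G (code-kernel K)) proper)))
                          (equivColourings⁺ c (col (Coded.part K)) (code-kernel K))

  covered : ∀ {c} → c ∈ map col (filter proper? (parts n k)) → Any (c ≈_) (filter good? (allMaps n k))
  covered c∈ with ∈-map⁻ col c∈
  ... | π , π∈ , refl with ∈-allMaps n (col π)
  ...   | d , d∈ , col≗d = lose (∈-filter⁺ good? d∈ (Equivalence.from T-∧
            (subst T (isProper-kernel G same) (proj₂ (∈-filter⁻ proper? {xs = parts n k} π∈)) ,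
             isOnto⁺ (λ a → proj₁ (col-onto π a) , trans (sym (col≗d _)) (proj₂ (col-onto π a))))))
          (equivColourings⁺ (col π) d same)
    where
    same : SameKernel (col π) d
    same i j rewrite col≗d i | col≗d j = refl

-- Chromatic polynomials of graphs with maximum degree 2

∑maps-*ˡ : ∀ n {x} k (F : (Fin n → Fin x) → ℕ) → ∑maps n x (λ c → k * F c) ≡ k * ∑maps n x F
∑maps-*ˡ zero    k F = refl
∑maps-*ˡ (suc n) k F = trans (∑maps-cong n (λ c → ∑-*ˡ k (λ a → F (a ∷ᶠ c)))) (∑maps-*ˡ n k _)

∑maps-1 : ∀ n x → ∑maps n x (λ _ → 1) ≡ x ^ n
∑maps-1 zero    x = refl
∑maps-1 (suc n) x = begin
  ∑maps n x (λ _ → ∑ {x} (λ _ → 1))  ≡⟨ ∑maps-cong n (λ _ → ∑-const x 1) ⟩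
  ∑maps n x (λ _ → x * 1)            ≡⟨ ∑maps-*ˡ n x (λ _ → 1) ⟩
  x * ∑maps n x (λ _ → 1)            ≡⟨ cong (x *_) (∑maps-1 n x) ⟩
  x ^ suc n                          ∎
  where open ≡-Reasoning

Extensional : ∀ {n x} → ((Fin n → Fin x) → ℕ) → Set
Extensional F = ∀ {c d} → (∀ i → c i ≡ d i) → F c ≡ F d

infixl 6 _[_≔_]
_[_≔_] : ∀ {n x} → (Fin n → Fin x) → Fin n → Fin x → Fin n → Fin x
c [ a ≔ t ] = updateAt c a (const t)

≔-same : ∀ {n x} (c : Fin n → Fin x) a t → (c [ a ≔ t ]) a ≡ t
≔-same c a t = updateAt-updates a c

≔-other : ∀ {n x} (c : Fin n → Fin x) a t {b} → b ≢ a → (c [ a ≔ t ]) b ≡ c b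
≔-other c a t {b} b≢a = updateAt-minimal b a c b≢a

∷ᶠ-cong : ∀ {n x} (a : Fin x) {c d : Fin n → Fin x} → (∀ i → c i ≡ d i) → ∀ i → (a ∷ᶠ c) i ≡ (a ∷ᶠ d) i
∷ᶠ-cong a c≗d fzero    = refl
∷ᶠ-cong a c≗d (fsuc i) = c≗d i

-- The colour at `a` is overwritten by t, so every map arises once for each of the x former colours
-- of `a`. Extensionality of `F` is required because the updated maps agree only pointwise.
∑maps-resample : ∀ n {x} (a : Fin n) (F : (Fin n → Fin x) → ℕ) → Extensional F →
  x * ∑maps n x F ≡ ∑maps n x (λ c → ∑ (λ t → F (c [ a ≔ t ])))
∑maps-resample (suc n) {x} fzero F ext = sym (begin
  ∑maps n x (λ c → ∑ (λ s → ∑ (λ t → F ((s ∷ᶠ c) [ fzero ≔ t ]))))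
    ≡⟨ ∑maps-cong n (λ c → ∑-cong {x} λ s → ∑-cong {x} λ t → ext {c = (s ∷ᶠ c) [ fzero ≔ t ]} {t ∷ᶠ c} λ { fzero → refl ; (fsuc i) → refl }) ⟩
  ∑maps n x (λ c → ∑ {x} (λ s → ∑ (λ t → F (t ∷ᶠ c))))
    ≡⟨ ∑maps-cong n (λ c → ∑-const x (∑ (λ t → F (t ∷ᶠ c)))) ⟩
  ∑maps n x (λ c → x * ∑ (λ t → F (t ∷ᶠ c)))
    ≡⟨ ∑maps-*ˡ n x _ ⟩
  x * ∑maps n x (λ c → ∑ (λ t → F (t ∷ᶠ c))) ∎)
  where open ≡-Reasoning
∑maps-resample (suc n) {x} (fsuc a) F ext = begin
  x * ∑maps n x (λ c → ∑ (λ s → F (s ∷ᶠ c)))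
    ≡⟨ ∑maps-resample n a (λ c → ∑ (λ s → F (s ∷ᶠ c))) (λ c≗d → ∑-cong λ s → ext (∷ᶠ-cong s c≗d)) ⟩
  ∑maps n x (λ c → ∑ (λ t → ∑ (λ s → F (s ∷ᶠ (c [ a ≔ t ])))))
    ≡⟨ ∑maps-cong n (λ c → ∑-comm {x} {x} (λ t s → F (s ∷ᶠ (c [ a ≔ t ])))) ⟩
  ∑maps n x (λ c → ∑ (λ s → ∑ (λ t → F (s ∷ᶠ (c [ a ≔ t ])))))
    ≡⟨ ∑maps-cong n (λ c → ∑-cong {x} λ s → ∑-cong {x} λ t →
         ext {c = s ∷ᶠ (c [ a ≔ t ])} {(s ∷ᶠ c) [ fsuc a ≔ t ]} λ { fzero → refl ; (fsuc i) → refl }) ⟩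
  ∑maps n x (λ c → ∑ (λ s → ∑ (λ t → F ((s ∷ᶠ c) [ fsuc a ≔ t ])))) ∎
  where open ≡-Reasoning

-- Edge lists, and summing out the colour of one vertex

Edges : ℕ → Set
Edges n = List (Fin n × Fin n)

differ : ∀ {x} → Fin x → Fin x → ℕ
differ p q = 𝟙 (not (p ==ᶠ q))

differ-sym : ∀ {x} (p q : Fin x) → differ p q ≡ differ q p
differ-sym p q = cong (𝟙 ∘ not) (==ᶠ-cong {a = p} {q} {q} {p} sym sym)

χ : ∀ {n x} → Edges n → (Fin n → Fin x) → ℕ
χ []            c = 1
χ ((u , v) ∷ E) c = differ (c u) (c v) * χ E c

χ-ext : ∀ {n x} (E : Edges n) → Extensional {n} {x} (χ E)
χ-ext []            c≗d = refl
χ-ext ((u , v) ∷ E) c≗d = cong₂ _*_ (cong₂ differ (c≗d u) (c≗d v)) (χ-ext E c≗d)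

incidence : ∀ {n} → Fin n → Fin n → Fin n → ℕ
incidence u v w = 𝟙 (u ==ᶠ w) + 𝟙 (v ==ᶠ w)

incidence-comm : ∀ {n} (u v w : Fin n) → incidence u v w ≡ incidence v u w
incidence-comm u v w = +-comm (𝟙 (u ==ᶠ w)) _

incidenceˡ : ∀ {n} (u v : Fin n) → 1 ≤ incidence u v u
incidenceˡ u v = ≤-trans (≤-reflexive (cong 𝟙 (sym (==ᶠ-true {a = u} refl)))) (m≤m+n _ _)

deg : ∀ {n} → Edges n → Fin n → ℕ
deg []            w = 0
deg ((u , v) ∷ E) w = incidence u v w + deg E w

Joins : ∀ {n} → Edges n → Fin n → Fin n → Set
Joins E u v = (u , v) ∈ E ⊎ (v , u) ∈ E

data Simple {n} : Edges n → Set where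
  []  : Simple []
  _∷_ : ∀ {u v E} → u ≢ v × ¬ Joins E u v → Simple E → Simple ((u , v) ∷ E)

-- One edge at `a`, wherever it stands in the list, read as directed away from `a`; the fields are
-- what the removal of walks has to know about the remaining edges.
record Extract {n} (a : Fin n) (E : Edges n) : Set where
  field
    end      : Fin n
    rest     : Edges n
    χ-≡      : ∀ {x} (c : Fin n → Fin x) → χ E c ≡ differ (c a) (c end) * χ rest c
    deg-≡    : ∀ w → deg E w ≡ incidence a end w + deg rest w
    length-≡ : length E ≡ suc (length rest)
    joins    : Joins E a end
    rest⊆    : ∀ {u v} → Joins rest u v → Joins E u v
    a≢end    : Simple E → a ≢ end
    simple   : Simple E → Simple rest

extract : ∀ {n} (a : Fin n) (E : Edges n) → deg E a ≡ 0 ⊎ Extract a E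
extract a [] = inj₁ refl
extract a ((u , v) ∷ E) with u ≟ᶠ a | v ≟ᶠ a
... | yes refl | _ = inj₂ record
  { end = v ; rest = E ; χ-≡ = λ c → refl ; deg-≡ = λ w → refl ; length-≡ = refl
  ; joins = inj₁ (here refl) ; rest⊆ = Sum.map there there
  ; a≢end = λ { ((u≢v , _) ∷ _) → u≢v } ; simple = λ { (_ ∷ s) → s } }
... | no _ | yes refl = inj₂ record
  { end = u ; rest = E ; χ-≡ = λ c → cong (_* χ E c) (differ-sym (c u) (c v))
  ; deg-≡ = λ w → cong (_+ deg E w) (incidence-comm u v w) ; length-≡ = refl
  ; joins = inj₂ (here refl) ; rest⊆ = Sum.map there there
  ; a≢end = λ { ((u≢v , _) ∷ _) → u≢v ∘ sym } ; simple = λ { (_ ∷ s) → s } }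
... | no _ | no _ with extract a E
...   | inj₁ deg≡0 = inj₁ deg≡0
...   | inj₂ X = inj₂ record
  { end = end ; rest = (u , v) ∷ rest
  ; χ-≡ = λ c → trans (cong (differ (c u) (c v) *_) (χ-≡ c)) (swap* (differ (c u) (c v)) (differ (c a) (c end)) (χ rest c))
  ; deg-≡ = λ w → trans (cong (incidence u v w +_) (deg-≡ w)) (swap+ (incidence u v w) (incidence a end w) (deg rest w))
  ; length-≡ = cong suc length-≡
  ; joins = Sum.map there there joins
  ; rest⊆ = λ { (inj₁ (here refl)) → inj₁ (here refl) ; (inj₂ (here refl)) → inj₂ (here refl)
              ; (inj₁ (there p)) → Sum.map there there (rest⊆ (inj₁ p))
              ; (inj₂ (there p)) → Sum.map there there (rest⊆ (inj₂ p)) }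
  ; a≢end = λ { (_ ∷ s) → a≢end s }
  ; simple = λ { ((u≢v , ¬joins) ∷ s) → (u≢v , ¬joins ∘ rest⊆) ∷ simple s } }
  where
  open Extract X
  swap* : ∀ p q r → p * (q * r) ≡ q * (p * r)
  swap* = solve-∀
  swap+ : ∀ p q r → p + (q + r) ≡ q + (p + r)
  swap+ = solve-∀

χ-≔ : ∀ {n x} (E : Edges n) {a} → deg E a ≡ 0 → (c : Fin n → Fin x) → ∀ t → χ E (c [ a ≔ t ]) ≡ χ E c
χ-≔ [] _ c t = refl
χ-≔ ((u , v) ∷ E) {a} deg≡0 c t with u ≟ᶠ a | v ≟ᶠ a
... | no u≢a | no v≢a = cong₂ _*_ (cong₂ differ (≔-other c a t u≢a) (≔-other c a t v≢a)) (χ-≔ E deg≡0 c t)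

edgeCount : ∀ {n} → Edges n → ℕ → ℕ
edgeCount {n} E x = ∑maps n x (χ E)

weight : ∀ {x} → ℕ → ℕ → Fin x → Fin x → ℕ
weight α β p q = 𝟙 (p ==ᶠ q) * α + differ p q * β

weight-diff : ∀ {x} α β {p q : Fin x} → p ≢ q → weight α β p q ≡ β
weight-diff α β {p} {q} p≢q rewrite ==ᶠ-false p≢q = +-identityʳ β

-- Adding β at t = q turns both sides into sums of constants and delta functions.
∑-weight : ∀ z α β (q : Fin (2 + z)) → ∑ (λ t → weight α β t q) ≡ α + suc z * β
∑-weight z α β q = +-cancelʳ-≡ β _ _ (begin
  ∑ (λ t → weight α β t q) + β                            ≡⟨ cong (∑ (λ t → weight α β t q) +_) (∑-δ q (λ _ → β)) ⟨
  ∑ (λ t → weight α β t q) + ∑ (λ t → 𝟙 (t ==ᶠ q) * β)    ≡⟨ ∑-+ (λ t → weight α β t q) (λ t → 𝟙 (t ==ᶠ q) * β) ⟨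
  ∑ (λ t → weight α β t q + 𝟙 (t ==ᶠ q) * β)              ≡⟨ ∑-cong (λ t → pointwise (t ==ᶠ q)) ⟩
  ∑ (λ t → 𝟙 (t ==ᶠ q) * α + β)                           ≡⟨ ∑-+ (λ t → 𝟙 (t ==ᶠ q) * α) (λ _ → β) ⟩
  ∑ (λ t → 𝟙 (t ==ᶠ q) * α) + ∑ {2 + z} (λ _ → β)         ≡⟨ cong₂ _+_ (∑-δ q (λ _ → α)) (∑-const (2 + z) β) ⟩
  α + (2 + z) * β                                         ≡⟨ lem α β z ⟩
  α + suc z * β + β                                       ∎)
  where
  open ≡-Reasoning
  pointwise : ∀ b → 𝟙 b * α + 𝟙 (not b) * β + 𝟙 b * β ≡ 𝟙 b * α + β
  pointwise true  = l α β
    where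
    l : ∀ α β → 1 * α + 0 * β + 1 * β ≡ 1 * α + β
    l = solve-∀
  pointwise false = l α β
    where
    l : ∀ α β → 0 * α + 1 * β + 0 * β ≡ 0 * α + β
    l = solve-∀
  lem : ∀ α β z → α + (2 + z) * β ≡ α + suc z * β + β
  lem = solve-∀

∑-weight-differ-same : ∀ z α β (q : Fin (2 + z)) → ∑ (λ t → weight α β t q * differ t q) ≡ suc z * β
∑-weight-differ-same z α β q = trans (∑-cong (λ t → pointwise (t ==ᶠ q))) (∑-weight z 0 β q)
  where
  pointwise : ∀ b → (𝟙 b * α + 𝟙 (not b) * β) * 𝟙 (not b) ≡ 𝟙 b * 0 + 𝟙 (not b) * β
  pointwise true  = *-zeroʳ (1 * α + 0)
  pointwise false = *-identityʳ _

-- One step of the transfer matrix of the complete graph on x = z + 2 colours: the pair (α , β)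
-- becomes ((x-1) β , α + (x-2) β), the recursion of `closedWalks` and `openWalks`.
∑-weight-differ : ∀ z α β (p q : Fin (2 + z)) →
  ∑ (λ t → weight α β t q * differ t p) ≡ weight (suc z * β) (α + z * β) p q
∑-weight-differ z α β p q with p ≟ᶠ q
... | yes refl = trans (∑-weight-differ-same z α β q) (sym (trans (+-identityʳ _) (+-identityʳ _)))
... | no  p≢q  = +-cancelʳ-≡ β _ _ (begin
  ∑ (λ t → weight α β t q * differ t p) + β
    ≡⟨ cong (∑ (λ t → weight α β t q * differ t p) +_) (∑-δ p (λ _ → β)) ⟨
  ∑ (λ t → weight α β t q * differ t p) + ∑ (λ t → 𝟙 (t ==ᶠ p) * β)
    ≡⟨ ∑-+ (λ t → weight α β t q * differ t p) (λ t → 𝟙 (t ==ᶠ p) * β) ⟨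
  ∑ (λ t → weight α β t q * differ t p + 𝟙 (t ==ᶠ p) * β)
    ≡⟨ ∑-cong pointwise ⟩
  ∑ (λ t → weight α β t q)
    ≡⟨ ∑-weight z α β q ⟩
  α + suc z * β
    ≡⟨ lem α β z ⟩
  α + z * β + 0 + β ∎)
  where
  open ≡-Reasoning
  lem : ∀ α β z → α + suc z * β ≡ α + z * β + 0 + β
  lem = solve-∀
  pointwise : ∀ t → weight α β t q * differ t p + 𝟙 (t ==ᶠ p) * β ≡ weight α β t q
  pointwise t with t ≟ᶠ p
  ... | no  _    = trans (+-identityʳ _) (*-identityʳ _)
  ... | yes refl = trans (cong (_+ 1 * β) (*-zeroʳ (weight α β t q))) (trans (+-identityʳ β) (sym (weight-diff α β p≢q)))

pairCount : ∀ {n} → Edges n → Fin n → Fin n → ℕ → ℕ → ℕ → ℕ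
pairCount {n} E a b α β x = ∑maps n x (λ c → weight α β (c a) (c b) * χ E c)

private
  resample-χ : ∀ {n x} (E : Edges n) {a} → deg E a ≡ 0 → (K : (Fin n → Fin x) → ℕ) → Extensional K →
    x * ∑maps n x (λ c → K c * χ E c) ≡ ∑maps n x (λ c → ∑ (λ t → K (c [ a ≔ t ])) * χ E c)
  resample-χ {n} {x} E {a} deg≡0 K ext = trans
    (∑maps-resample n a _ (λ c≗d → cong₂ _*_ (ext c≗d) (χ-ext E c≗d)))
    (∑maps-cong n λ c → trans (∑-cong {x} λ t → cong (K (c [ a ≔ t ]) *_) (χ-≔ E deg≡0 c t)) (∑-*ʳ (χ E c) (λ t → K (c [ a ≔ t ]))))

pairCount-isolated : ∀ {n} (E : Edges n) {a b} → b ≢ a → deg E a ≡ 0 → ∀ α β z →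
  (2 + z) * pairCount E a b α β (2 + z) ≡ (α + suc z * β) * edgeCount E (2 + z)
pairCount-isolated {n} E {a} {b} b≢a deg≡0 α β z = begin
  (2 + z) * pairCount E a b α β (2 + z)
    ≡⟨ resample-χ E deg≡0 (λ c → weight α β (c a) (c b)) (λ c≗d → cong₂ (weight α β) (c≗d a) (c≗d b)) ⟩
  ∑maps n (2 + z) (λ c → ∑ (λ t → weight α β ((c [ a ≔ t ]) a) ((c [ a ≔ t ]) b)) * χ E c)
    ≡⟨ ∑maps-cong n (λ c → cong (_* χ E c) (trans
         (∑-cong (λ t → cong₂ (weight α β) (≔-same c a t) (≔-other c a t b≢a))) (∑-weight z α β (c b)))) ⟩
  ∑maps n (2 + z) (λ c → (α + suc z * β) * χ E c)
    ≡⟨ ∑maps-*ˡ n (α + suc z * β) (χ E) ⟩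
  (α + suc z * β) * edgeCount E (2 + z) ∎
  where open ≡-Reasoning

module _ {n} {a : Fin n} {E : Edges n} (X : Extract a E) where
  open Extract X

  private
    pull : ∀ {b} → b ≢ a → end ≢ a → deg rest a ≡ 0 → ∀ α β x →
      x * pairCount E a b α β x ≡ ∑maps n x (λ c → ∑ (λ t → weight α β t (c b) * differ t (c end)) * χ rest c)
    pull {b} b≢a end≢a deg≡0 α β x = begin
      x * pairCount E a b α β x
        ≡⟨ cong (x *_) (∑maps-cong n (λ c → trans (cong (weight α β (c a) (c b) *_) (χ-≡ c)) (sym (*-assoc (weight α β (c a) (c b)) _ _)))) ⟩
      x * ∑maps n x (λ c → weight α β (c a) (c b) * differ (c a) (c end) * χ rest c)
        ≡⟨ resample-χ rest deg≡0 (λ c → weight α β (c a) (c b) * differ (c a) (c end))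
             (λ c≗d → cong₂ _*_ (cong₂ (weight α β) (c≗d a) (c≗d b)) (cong₂ differ (c≗d a) (c≗d end))) ⟩
      ∑maps n x (λ c → ∑ (λ t → weight α β ((c [ a ≔ t ]) a) ((c [ a ≔ t ]) b) * differ ((c [ a ≔ t ]) a) ((c [ a ≔ t ]) end)) * χ rest c)
        ≡⟨ ∑maps-cong n (λ c → cong (_* χ rest c) (∑-cong λ t → cong₂ _*_
             (cong₂ (weight α β) (≔-same c a t) (≔-other c a t b≢a)) (cong₂ differ (≔-same c a t) (≔-other c a t end≢a)))) ⟩
      ∑maps n x (λ c → ∑ (λ t → weight α β t (c b) * differ t (c end)) * χ rest c) ∎
      where open ≡-Reasoning

  -- On the right `a` is isolated but still coloured freely, which is balanced by the factor 2 + z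
  -- on the left.
  pairCount-step : ∀ {b} → b ≢ a → end ≢ a → deg rest a ≡ 0 → ∀ α β z →
    (2 + z) * pairCount E a b α β (2 + z) ≡ pairCount rest end b (suc z * β) (α + z * β) (2 + z)
  pairCount-step {b} b≢a end≢a deg≡0 α β z = trans (pull b≢a end≢a deg≡0 α β (2 + z))
    (∑maps-cong n λ c → cong (_* χ rest c) (∑-weight-differ z α β (c end) (c b)))

  pairCount-close : end ≢ a → deg rest a ≡ 0 → ∀ α β z →
    (2 + z) * pairCount E a end α β (2 + z) ≡ suc z * β * edgeCount rest (2 + z)
  pairCount-close end≢a deg≡0 α β z = trans (pull end≢a end≢a deg≡0 α β (2 + z))
    (trans (∑maps-cong n λ c → cong (_* χ rest c) (∑-weight-differ-same z α β (c end))) (∑maps-*ˡ n (suc z * β) (χ rest)))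

-- The count is x^n times the product of the factors 1 - 1/x and c_m(x)/x^m; their denominators
-- multiply to x to the number of edges.
Factorisation : ∀ {n} → Edges n → Set
Factorisation {n} E = ∃ λ p → ∃ λ js → length E ≡ factoredSize p js ×
  (∀ z → edgeCount E (2 + z) * (2 + z) ^ length E ≡ (2 + z) ^ n * factored p js (2 + z))

-- A walk of k edges from b to a has been removed already; it weighs the colourings of the rest by
-- closedWalks k or openWalks k, according to whether a and b get the same colour.
WalkFactorisation : ∀ {n} → ℕ → Edges n → Fin n → Fin n → Set
WalkFactorisation {n} k E a b = ∃ λ p → ∃ λ js → k + length E ≡ factoredSize p js ×
  (∀ z → pairCount E a b (closedWalks k (2 + z)) (openWalks k (2 + z)) (2 + z) * (2 + z) ^ suc (length E)
         ≡ (2 + z) ^ n * factored p js (2 + z))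

-- The number m bounds the edges and drives the mutual recursion. The first edge is taken as a walk
-- of length 1, to be prolonged at its end `a`.
factorise : ∀ {n} m (E : Edges n) → length E ≤ m → Simple E → (∀ w → deg E w ≤ 2) → Factorisation E

-- The degree bound counts the removed walk as an edge ab, so at most one edge is left at `a`. If
-- there is none, the k+1 edges of the walk become factors 1 - 1/x; if it leads away from b, the
-- walk grows; if it leads to b, a cycle of k+2 edges closes. The condition for k = 0 forbids a
-- cycle of two edges.
factoriseWalk : ∀ {n} m k (E : Edges n) a b → length E ≤ m → Simple E → b ≢ a → (k ≡ 0 → ¬ Joins E a b) →
  (∀ w → incidence a b w + deg E w ≤ 2) → WalkFactorisation (suc k) E a b

factorise {n} m [] _ _ _ = 0 , [] , refl , λ z → trans (cong (_* 1) (∑maps-1 n (2 + z))) refl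
factorise {n} (suc m) ((a , b) ∷ E) (s≤s len) ((a≢b , ¬joins) ∷ E-simple) deg≤2
  with factoriseWalk m 0 E a b len E-simple (a≢b ∘ sym) (λ _ → ¬joins) deg≤2
... | p , js , size , eq = p , js , size , λ z → trans
  (cong (_* (2 + z) ^ suc (length E)) (∑maps-cong n λ c → cong (_* χ E c) (single z (c a ==ᶠ c b)))) (eq z)
  where
  single : ∀ z t → 𝟙 (not t) ≡ 𝟙 t * (suc z * 0) + 𝟙 (not t) * (1 + z * 0)
  single z true  rewrite *-zeroʳ z = refl
  single z false rewrite *-zeroʳ z = refl

factoriseWalk {n} m k E a b len E-simple b≢a ¬joins deg≤2 with extract a E
... | inj₁ deg≡0 with factorise m E len E-simple (λ w → ≤-trans (m≤n+m _ _) (deg≤2 w))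
...   | p , js , size , eq = suc k + p , js , trans (cong (suc k +_) size) (sym (+-assoc (suc k) p _)) , λ z → begin
  pairCount E a b (closedWalks (suc k) (2 + z)) (openWalks (suc k) (2 + z)) (2 + z) * ((2 + z) * (2 + z) ^ length E)
    ≡⟨ lem₁ (pairCount E a b (closedWalks (suc k) (2 + z)) (openWalks (suc k) (2 + z)) (2 + z)) (2 + z) ((2 + z) ^ length E) ⟩
  (2 + z) * pairCount E a b (closedWalks (suc k) (2 + z)) (openWalks (suc k) (2 + z)) (2 + z) * (2 + z) ^ length E
    ≡⟨ cong (_* (2 + z) ^ length E) (pairCount-isolated E b≢a deg≡0 _ _ z) ⟩
  (closedWalks (suc k) (2 + z) + suc z * openWalks (suc k) (2 + z)) * edgeCount E (2 + z) * (2 + z) ^ length E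
    ≡⟨ cong (λ s → s * edgeCount E (2 + z) * (2 + z) ^ length E) (walks-total (suc k) z) ⟩
  suc z ^ suc k * edgeCount E (2 + z) * (2 + z) ^ length E
    ≡⟨ trans (*-assoc (suc z ^ suc k) _ _) (cong (suc z ^ suc k *_) (eq z)) ⟩
  suc z ^ suc k * ((2 + z) ^ n * (suc z ^ p * cyclesPoly js (2 + z)))
    ≡⟨ lem₂ (suc z ^ suc k) ((2 + z) ^ n) (suc z ^ p) (cyclesPoly js (2 + z)) ⟩
  (2 + z) ^ n * (suc z ^ suc k * suc z ^ p * cyclesPoly js (2 + z))
    ≡⟨ cong (λ s → (2 + z) ^ n * (s * cyclesPoly js (2 + z))) (^-distribˡ-+-* (suc z) (suc k) p) ⟨
  (2 + z) ^ n * factored (suc k + p) js (2 + z) ∎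
  where
  open ≡-Reasoning
  lem₁ : ∀ a b c → a * (b * c) ≡ b * a * c
  lem₁ = solve-∀
  lem₂ : ∀ a b c d → a * (b * (c * d)) ≡ b * (a * c * d)
  lem₂ = solve-∀
factoriseWalk {n} zero k E a b len E-simple b≢a ¬joins deg≤2 | inj₂ X =
  contradiction (trans (sym (n≤0⇒n≡0 len)) (Extract.length-≡ X)) λ ()
factoriseWalk {n} (suc m) k E a b len E-simple b≢a ¬joins deg≤2 | inj₂ X with Extract.end X ≟ᶠ b
... | no end≢b with factoriseWalk m (suc k) (Extract.rest X) (Extract.end X) b
                      (≤-pred (≤-trans (≤-reflexive (sym (Extract.length-≡ X))) len)) (Extract.simple X E-simple) (end≢b ∘ sym) (λ ())
                      (λ w → ≤-trans (lower w) (deg≤2 w))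
  where
  open Extract X
  lower : ∀ w → incidence end b w + deg rest w ≤ incidence a b w + deg E w
  lower w rewrite deg-≡ w = ≤-trans (m≤m+n _ (𝟙 (a ==ᶠ w) + 𝟙 (a ==ᶠ w))) (≤-reflexive (lem (𝟙 (a ==ᶠ w)) (𝟙 (b ==ᶠ w)) (𝟙 (end ==ᶠ w)) (deg rest w)))
    where
    lem : ∀ i j k d → k + j + d + (i + i) ≡ i + j + (i + k + d)
    lem = solve-∀
...   | p , js , size , eq = p , js , trans (trans (cong (suc k +_) length-≡) (+-suc (suc k) (length rest))) size , λ z → begin
  pairCount E a b (closedWalks (suc k) (2 + z)) (openWalks (suc k) (2 + z)) (2 + z) * ((2 + z) * (2 + z) ^ length E)
    ≡⟨ lem₁ (pairCount E a b (closedWalks (suc k) (2 + z)) (openWalks (suc k) (2 + z)) (2 + z)) (2 + z) ((2 + z) ^ length E) ⟩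
  (2 + z) * pairCount E a b (closedWalks (suc k) (2 + z)) (openWalks (suc k) (2 + z)) (2 + z) * (2 + z) ^ length E
    ≡⟨ cong₂ (λ s l → s * (2 + z) ^ l) (pairCount-step X b≢a (a≢end E-simple ∘ sym) (isolated X) _ _ z) length-≡ ⟩
  pairCount rest end b (closedWalks (2 + k) (2 + z)) (openWalks (2 + k) (2 + z)) (2 + z) * (2 + z) ^ suc (length rest)
    ≡⟨ eq z ⟩
  (2 + z) ^ n * factored p js (2 + z) ∎
  where
  open ≡-Reasoning
  open Extract X
  lem₁ : ∀ a b c → a * (b * c) ≡ b * a * c
  lem₁ = solve-∀
  -- The walk and the extracted edge exhaust the degree 2 of `a`.
  isolated : (X : Extract a E) → deg (Extract.rest X) a ≡ 0
  isolated X = n≤0⇒n≡0 (+-cancelˡ-≤ 2 _ _ (≤-trans (+-monoˡ-≤ (deg (Extract.rest X) a) (+-mono-≤ (incidenceˡ a b) (incidenceˡ a (Extract.end X))))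
    (≤-trans (≤-reflexive (trans (+-assoc (incidence a b a) _ _) (cong (incidence a b a +_) (sym (Extract.deg-≡ X a))))) (deg≤2 a))))
factoriseWalk {n} (suc m) k E a b len E-simple b≢a ¬joins deg≤2 | inj₂ X | yes refl with k
... | zero = contradiction (Extract.joins X) (¬joins refl)
... | suc j with factorise m (Extract.rest X)
                   (≤-pred (≤-trans (≤-reflexive (sym (Extract.length-≡ X))) len)) (Extract.simple X E-simple)
                   (λ w → ≤-trans (≤-trans (m≤n+m _ (incidence a (Extract.end X) w)) (≤-trans (≤-reflexive (sym (Extract.deg-≡ X w))) (m≤n+m _ _))) (deg≤2 w))
...   | p , js , size , eq = p , j ∷ js , trans (cong (2 + j +_) (trans length-≡ (cong suc size))) (lem₀ j p (cyclesSize js)) , λ z → begin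
  pairCount E a end (closedWalks (2 + j) (2 + z)) (openWalks (2 + j) (2 + z)) (2 + z) * ((2 + z) * (2 + z) ^ length E)
    ≡⟨ lem₁ (pairCount E a end (closedWalks (2 + j) (2 + z)) (openWalks (2 + j) (2 + z)) (2 + z)) (2 + z) ((2 + z) ^ length E) ⟩
  (2 + z) * pairCount E a end (closedWalks (2 + j) (2 + z)) (openWalks (2 + j) (2 + z)) (2 + z) * (2 + z) ^ length E
    ≡⟨ cong₂ (λ s l → s * (2 + z) ^ l) (pairCount-close X (a≢end E-simple ∘ sym) isolated _ _ z) length-≡ ⟩
  suc z * openWalks (2 + j) (2 + z) * edgeCount rest (2 + z) * ((2 + z) * (2 + z) ^ length rest)
    ≡⟨ lem₂ (suc z) (openWalks (2 + j) (2 + z)) (edgeCount rest (2 + z)) (2 + z) _ ⟩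
  cyclePoly (2 + j) (2 + z) * (edgeCount rest (2 + z) * (2 + z) ^ length rest)
    ≡⟨ cong (cyclePoly (2 + j) (2 + z) *_) (eq z) ⟩
  cyclePoly (2 + j) (2 + z) * ((2 + z) ^ n * (suc z ^ p * cyclesPoly js (2 + z)))
    ≡⟨ lem₃ (cyclePoly (2 + j) (2 + z)) ((2 + z) ^ n) (suc z ^ p) (cyclesPoly js (2 + z)) ⟩
  (2 + z) ^ n * factored p (j ∷ js) (2 + z) ∎
  where
  open ≡-Reasoning
  open Extract X
  lem₀ : ∀ j p s → 2 + j + suc (p + s) ≡ p + (3 + j + s)
  lem₀ = solve-∀
  lem₁ : ∀ a b c → a * (b * c) ≡ b * a * c
  lem₁ = solve-∀
  lem₂ : ∀ y b e x r → y * b * e * (x * r) ≡ x * y * b * (e * r)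
  lem₂ = solve-∀
  lem₃ : ∀ c x q s → c * (x * (q * s)) ≡ x * (q * (c * s))
  lem₃ = solve-∀
  isolated : deg rest a ≡ 0
  isolated = n≤0⇒n≡0 (+-cancelˡ-≤ 2 _ _ (≤-trans (+-monoˡ-≤ (deg rest a) (+-mono-≤ (incidenceˡ a end) (incidenceˡ a end)))
    (≤-trans (≤-reflexive (trans (+-assoc (incidence a end a) _ _) (cong (incidence a end a +_) (sym (deg-≡ a))))) (deg≤2 a))))

-- From graphs to edge lists; cherries

T-antisym : ∀ {a b} → (T a → T b) → (T b → T a) → a ≡ b
T-antisym {true}  {true}  _ _ = refl
T-antisym {false} {false} _ _ = refl
T-antisym {true}  {false} f _ = ⊥-elim (f tt)
T-antisym {false} {true}  _ g = ⊥-elim (g tt)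

𝟙-true : ∀ {b} → T b → 𝟙 b ≡ 1
𝟙-true {true} _ = refl

𝟙-false : ∀ {b} → ¬ T b → 𝟙 b ≡ 0
𝟙-false {true}  ¬b = ⊥-elim (¬b tt)
𝟙-false {false} _  = refl

isProper⁺ : ∀ {n k} (G : Graph n) (c : Fin n → Fin k) → (∀ i j → T (adj G i j) → c i ≢ c j) → T (isProper G c)
isProper⁺ G c h = all-allFin⁺ λ i → all-allFin⁺ λ j → nand (adj G i j) (c i ==ᶠ c j) (λ a eq → h i j a (toWitness eq))
  where
  nand : ∀ a b → (T a → ¬ T b) → T (not (a ∧ b))
  nand true  true  ¬ab = ¬ab tt tt
  nand true  false _   = tt
  nand false _     _   = tt

isProper⁻ : ∀ {n k} (G : Graph n) (c : Fin n → Fin k) → T (isProper G c) → ∀ i j → T (adj G i j) → c i ≢ c j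
isProper⁻ G c h i j a eq = nand (adj G i j) (c i ==ᶠ c j) (all-allFin⁻ (all-allFin⁻ h i) j) a (fromWitness eq)
  where
  nand : ∀ a b → T (not (a ∧ b)) → T a → ¬ T b
  nand true true () _ _

χ-one : ∀ {n x} (E : Edges n) (c : Fin n → Fin x) → (∀ {u v} → (u , v) ∈ E → c u ≢ c v) → χ E c ≡ 1
χ-one []            c _ = refl
χ-one ((u , v) ∷ E) c h rewrite ==ᶠ-false (h (here refl)) = trans (+-identityʳ _) (χ-one E c (h ∘ there))

χ-zero : ∀ {n x} (E : Edges n) (c : Fin n → Fin x) {u v} → (u , v) ∈ E → c u ≡ c v → χ E c ≡ 0
χ-zero (_ ∷ E)       c (here refl) eq rewrite ==ᶠ-true eq = refl
χ-zero ((u , v) ∷ E) c (there e∈)  eq = trans (cong (differ (c u) (c v) *_) (χ-zero E c e∈ eq)) (*-zeroʳ (differ (c u) (c v)))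

Represents : ∀ {n} → Edges n → Graph n → Set
Represents E G = ∀ i j → T (adj G i j) ⇔ Joins E i j

isProper-χ : ∀ {n x} {E : Edges n} {G : Graph n} → Represents E G → (c : Fin n → Fin x) → 𝟙 (isProper G c) ≡ χ E c
isProper-χ {E = E} {G} rep c with Any.any? (λ (u , v) → c u ≟ᶠ c v) E
... | yes clash with find clash
...   | (u , v) , e∈ , eq = trans
        (𝟙-false (λ proper → isProper⁻ G c proper u v (Equivalence.from (rep u v) (inj₁ e∈)) eq))
        (sym (χ-zero E c e∈ eq))
isProper-χ {E = E} {G} rep c | no ¬clash = trans
  (𝟙-true (isProper⁺ G c λ i j a eq → ¬clash (clash (Equivalence.to (rep i j) a) eq)))
  (sym (χ-one E c λ e∈ eq → ¬clash (lose e∈ eq)))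
  where
  clash : ∀ {i j} → Joins E i j → c i ≡ c j → Any (λ (u , v) → c u ≡ c v) E
  clash (inj₁ e∈) eq = lose e∈ eq
  clash (inj₂ e∈) eq = lose e∈ (sym eq)

chromatic≡edgeCount : ∀ {n} {E : Edges n} {G : Graph n} → Represents E G → ∀ x → chromatic G x ≡ edgeCount E x
chromatic≡edgeCount {n} {E} {G} rep x = ∑maps-cong n (isProper-χ {E = E} {G} rep)

chromatic-zero : ∀ {n} (G : Graph n) {i j} → T (adj G i j) → ∀ {x} → x < 2 → chromatic G x ≡ 0
chromatic-zero {n} G {i} {j} a {x} x<2 = trans
  (∑maps-cong n (λ c → 𝟙-false (λ proper → isProper⁻ G c proper i j a (collapse x<2 (c i) (c j)))))
  (∑maps-*ˡ n 0 (λ _ → 0))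
  where
  collapse : ∀ {x} → x < 2 → (p q : Fin x) → p ≡ q
  collapse {suc zero}    _              fzero fzero = refl
  collapse {suc (suc x)} (s≤s (s≤s ()))

module _ {n} (G : Graph n) where

  isEdge? : ∀ (e : Fin n × Fin n) → Dec (T (adj G (proj₁ e) (proj₂ e)) × proj₁ e <ᶠ proj₂ e)
  isEdge? (i , j) = T? (adj G i j) ×-dec (i <ᶠ? j)

  edges : Edges n
  edges = filter isEdge? (cartesianProduct (allFin n) (allFin n))

  adj-edge : ∀ {i j} → T (adj G i j) → i <ᶠ j → (i , j) ∈ edges
  adj-edge {i} {j} a i<j = ∈-filter⁺ isEdge? (∈-cartesianProduct⁺ (∈-allFin i) (∈-allFin j)) (a , i<j)

  edge-adj : ∀ {i j} → (i , j) ∈ edges → T (adj G i j)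
  edge-adj e∈ = proj₁ (proj₂ (∈-filter⁻ isEdge? {xs = cartesianProduct (allFin n) (allFin n)} e∈))

  adj-irreflexive : ∀ {i j} → T (adj G i j) → i ≢ j
  adj-irreflexive {i} a refl rewrite irref G i = a

  edges-represent : Represents edges G
  edges-represent i j = mk⇔ to (λ { (inj₁ e∈) → edge-adj e∈ ; (inj₂ e∈) → subst T (adj-sym G j i) (edge-adj e∈) })
    where
    to : T (adj G i j) → Joins edges i j
    to a with <ᶠ-cmp i j
    ... | tri< i<j _ _ = inj₁ (adj-edge a i<j)
    ... | tri≈ _ i≡j _ = contradiction i≡j (adj-irreflexive a)
    ... | tri> _ _ j<i = inj₂ (adj-edge (subst T (adj-sym G i j) a) j<i)

  edges-simple : Simple edges
  edges-simple = increasing⇒simple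
    (All.map proj₂ (all-filter isEdge? (cartesianProduct (allFin n) (allFin n))))
    (Unique.filter⁺ isEdge? (Unique.cartesianProduct⁺ (Unique.allFin⁺ n) (Unique.allFin⁺ n)))
    where
    increasing⇒simple : ∀ {E : Edges n} → All (λ e → proj₁ e <ᶠ proj₂ e) E → Unique E → Simple E
    increasing⇒simple []          []          = []
    increasing⇒simple (u<v ∷ inc) (e∉E ∷ uni) =
      ( (λ u≡v → <⇒≢ u<v (cong toℕ u≡v))
      , (λ { (inj₁ e∈) → All.lookup e∉E e∈ refl ; (inj₂ e∈) → <-asym u<v (All.lookup inc e∈) })
      ) ∷ increasing⇒simple inc uni

  -- Each neighbour j of w is counted through (w , j) or (j , w), and only the increasing pair is
  -- listed.
  deg-edges : ∀ w → deg edges w ≤ degree G w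
  deg-edges w = begin
    deg edges w
      ≡⟨ deg-filter (cartesianProduct (allFin n) (allFin n)) ⟩
    sum (map term (cartesianProduct (allFin n) (allFin n)))
      ≡⟨ trans (sum-map-× _,_ term (allFin n) (allFin n)) (trans (∑-allFin n _) (∑-cong {n} λ i → ∑-allFin n (λ j → term (i , j)))) ⟩
    ∑ (λ i → ∑ (λ j → term (i , j)))
      ≡⟨ ∑-cong {n} (λ i → trans (∑-cong {n} (λ j → distrib (side i j) (𝟙 (i ==ᶠ w)) (𝟙 (j ==ᶠ w)))) (∑-+ {n} _ _)) ⟩
    ∑ (λ i → ∑ (λ j → 𝟙 (i ==ᶠ w) * side i j) + ∑ (λ j → 𝟙 (j ==ᶠ w) * side i j))
      ≡⟨ ∑-+ {n} (λ i → ∑ (λ j → 𝟙 (i ==ᶠ w) * side i j)) _ ⟩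
    ∑ (λ i → ∑ (λ j → 𝟙 (i ==ᶠ w) * side i j)) + ∑ (λ i → ∑ (λ j → 𝟙 (j ==ᶠ w) * side i j))
      ≡⟨ cong₂ _+_ (trans (∑-cong {n} (λ i → ∑-*ˡ (𝟙 (i ==ᶠ w)) (side i))) (∑-δ w (λ i → ∑ (side i))))
                   (∑-cong {n} (λ i → ∑-δ w (side i))) ⟩
    ∑ (side w) + ∑ (λ i → side i w)
      ≡⟨ ∑-+ {n} (side w) (λ i → side i w) ⟨
    ∑ (λ j → side w j + side j w)
      ≤⟨ ∑-mono n oneSide ⟩
    ∑ (λ j → 𝟙 (adj G w j))
      ≡⟨ trans (length-filter-T (adj G w) (allFin n)) (∑-allFin n (𝟙 ∘ adj G w)) ⟨
    degree G w ∎
    where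
    open ≤-Reasoning
    side : Fin n → Fin n → ℕ
    side i j = 𝟙 (does (isEdge? (i , j)))
    term : Fin n × Fin n → ℕ
    term (i , j) = side i j * incidence i j w
    deg-filter : ∀ xs → deg (filter isEdge? xs) w ≡ sum (map term xs)
    deg-filter [] = refl
    deg-filter ((i , j) ∷ xs) with does (isEdge? (i , j))
    ... | true  = cong₂ _+_ (sym (+-identityʳ _)) (deg-filter xs)
    ... | false = deg-filter xs
    distrib : ∀ s a b → s * (a + b) ≡ a * s + b * s
    distrib = solve-∀
    ∑-mono : ∀ n {f g : Fin n → ℕ} → (∀ i → f i ≤ g i) → ∑ f ≤ ∑ g
    ∑-mono zero    f≤g = z≤n
    ∑-mono (suc n) f≤g = +-mono-≤ (f≤g fzero) (∑-mono n (f≤g ∘ fsuc))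
    oneSide : ∀ j → side w j + side j w ≤ 𝟙 (adj G w j)
    oneSide j rewrite adj-sym G j w with adj G w j
    ... | false = ≤-refl
    ... | true  = exclusive (w <ᶠ? j) (j <ᶠ? w)
      where
      exclusive : (p : Dec (w <ᶠ j)) (q : Dec (j <ᶠ w)) → 𝟙 (does p) + 𝟙 (does q) ≤ 1
      exclusive (yes w<j) (yes j<w) = contradiction w<j (<-asym j<w)
      exclusive (yes _)   (no  _)   = ≤-refl
      exclusive (no  _)   (yes _)   = ≤-refl
      exclusive (no  _)   (no  _)   = z≤n

module _ {A : Set} (f : A → ℕ) where
  ⊔-upper : ∀ {x} xs → x ∈ xs → f x ≤ foldr _⊔_ 0 (map f xs)
  ⊔-upper (x ∷ xs) (here refl) = m≤m⊔n (f x) _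
  ⊔-upper (x ∷ xs) (there x∈)  = ≤-trans (⊔-upper xs x∈) (m≤n⊔m (f x) _)

  ⊔-attained : ∀ {m} xs → foldr _⊔_ 0 (map f xs) ≡ suc m → ∃ λ x → f x ≡ suc m
  ⊔-attained (x ∷ xs) eq with ⊔-sel (f x) (foldr _⊔_ 0 (map f xs))
  ... | inj₁ left  = x , trans (sym left) eq
  ... | inj₂ right = ⊔-attained xs (trans (sym right) eq)

-- A copy of K₁,₂ that need not be induced: in a triangle `left` and `right` are adjacent.
record Cherry {n} (G : Graph n) : Set where
  field
    {centre left right} : Fin n
    centre-left         : T (adj G centre left)
    centre-right        : T (adj G centre right)
    left≢right          : left ≢ right

  centre≢left : centre ≢ left
  centre≢left = adj-irreflexive G centre-left

  centre≢right : centre ≢ right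
  centre≢right = adj-irreflexive G centre-right

  cherryEdges : Edges n
  cherryEdges = (centre , left) ∷ (centre , right) ∷ []

  3≤n : 3 ≤ n
  3≤n = injective⇒≤ {f = place} λ {i} {j} → place-injective i j
    where
    place : Fin 3 → Fin n
    place fzero               = centre
    place (fsuc fzero)        = left
    place (fsuc (fsuc fzero)) = right
    place-injective : ∀ i j → place i ≡ place j → i ≡ j
    place-injective fzero fzero _ = refl
    place-injective fzero (fsuc fzero) eq = contradiction eq centre≢left
    place-injective fzero (fsuc (fsuc fzero)) eq = contradiction eq centre≢right
    place-injective (fsuc fzero) fzero eq = contradiction (sym eq) centre≢left
    place-injective (fsuc fzero) (fsuc fzero) _ = refl
    place-injective (fsuc fzero) (fsuc (fsuc fzero)) eq = contradiction eq left≢right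
    place-injective (fsuc (fsuc fzero)) fzero eq = contradiction (sym eq) centre≢right
    place-injective (fsuc (fsuc fzero)) (fsuc fzero) eq = contradiction (sym eq) left≢right
    place-injective (fsuc (fsuc fzero)) (fsuc (fsuc fzero)) _ = refl

  simple : Simple cherryEdges
  simple = (centre≢left , λ { (inj₁ (here eq)) → left≢right (cong proj₂ eq) ; (inj₂ (here eq)) → centre≢right (cong proj₂ eq) })
         ∷ (centre≢right , λ { (inj₁ ()) ; (inj₂ ()) }) ∷ []

  deg≤2 : ∀ w → deg cherryEdges w ≤ 2
  deg≤2 w with centre ≟ᶠ w | left ≟ᶠ w | right ≟ᶠ w
  ... | yes refl | yes eq   | _       = contradiction (sym eq) centre≢left
  ... | yes refl | no _     | yes eq  = contradiction (sym eq) centre≢right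
  ... | yes refl | no _     | no _    = ≤-refl
  ... | no _     | yes refl | yes eq  = contradiction (sym eq) left≢right
  ... | no _     | yes refl | no _    = s≤s z≤n
  ... | no _     | no _     | yes _   = s≤s z≤n
  ... | no _     | no _     | no _    = z≤n

maxDegree-cherry : ∀ {n} (G : Graph n) → maxDegree G ≡ 2 → Cherry G
maxDegree-cherry {n} G Δ≡2 with ⊔-attained (degree G) (allFin n) Δ≡2
... | v , degree≡2 = pick (filter (T? ∘ adj G v) (allFin n)) degree≡2
  (all-filter (T? ∘ adj G v) (allFin n)) (Unique.filter⁺ (T? ∘ adj G v) (Unique.allFin⁺ n))
  where
  pick : ∀ xs → length xs ≡ 2 → All (T ∘ adj G v) xs → Unique xs → Cherry G
  pick (a ∷ b ∷ []) _ (va ∷ vb ∷ []) ((a≢b ∷ []) ∷ _) = record { centre-left = va ; centre-right = vb ; left≢right = a≢b }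

Bare : ∀ {n} {G : Graph n} → Cherry G → Set
Bare {G = G} C = Represents (Cherry.cherryEdges C) G

-- The two edges of the cherry are distinct entries of `edges G` and fill it. Their listed
-- orientations depend on the numbering of the vertices, hence four cases.
two-edges-bare : ∀ {n} {G : Graph n} (C : Cherry G) → length (edges G) ≤ 2 → Bare C
two-edges-bare {n} {G} C len i j = mk⇔
  (λ a → classify (to (edges-represent G i j) a))
  (λ { (inj₁ (here refl)) → centre-left ; (inj₁ (there (here refl))) → centre-right
     ; (inj₂ (here refl)) → flip centre-left ; (inj₂ (there (here refl))) → flip centre-right })
  where
  open Cherry C
  open Equivalence
  flip : ∀ {i j} → T (adj G i j) → T (adj G j i)
  flip {i} {j} = subst T (adj-sym G i j)

  only-two : ∀ {E : Edges n} {e f g} → length E ≤ 2 → e ∈ E → f ∈ E → e ≢ f → g ∈ E → g ≡ e ⊎ g ≡ f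
  only-two {_ ∷ _ ∷ _ ∷ _} (s≤s (s≤s ()))
  only-two {_ ∷ []} _ (here refl) (here refl) e≢f _ = contradiction refl e≢f
  only-two {_ ∷ _ ∷ []} _ (here refl) (here refl) e≢f _ = contradiction refl e≢f
  only-two {_ ∷ _ ∷ []} _ (there (here refl)) (there (here refl)) e≢f _ = contradiction refl e≢f
  only-two {_ ∷ _ ∷ []} _ (here refl) (there (here refl)) _ (here refl) = inj₁ refl
  only-two {_ ∷ _ ∷ []} _ (here refl) (there (here refl)) _ (there (here refl)) = inj₂ refl
  only-two {_ ∷ _ ∷ []} _ (there (here refl)) (here refl) _ (here refl) = inj₂ refl
  only-two {_ ∷ _ ∷ []} _ (there (here refl)) (here refl) _ (there (here refl)) = inj₁ refl

  toCherry : ∀ {u v} → (u , v) ∈ edges G → Joins cherryEdges u v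
  toCherry e∈ with to (edges-represent G centre left) centre-left | to (edges-represent G centre right) centre-right
  ... | inj₁ p | inj₁ q with only-two len p q (λ eq → left≢right (cong proj₂ eq)) e∈
  ...   | inj₁ refl = inj₁ (here refl)
  ...   | inj₂ refl = inj₁ (there (here refl))
  toCherry e∈ | inj₁ p | inj₂ q with only-two len p q (λ eq → centre≢left (sym (cong proj₂ eq))) e∈
  ...   | inj₁ refl = inj₁ (here refl)
  ...   | inj₂ refl = inj₂ (there (here refl))
  toCherry e∈ | inj₂ p | inj₁ q with only-two len p q (λ eq → centre≢right (cong proj₂ eq)) e∈
  ...   | inj₁ refl = inj₂ (here refl)
  ...   | inj₂ refl = inj₁ (there (here refl))
  toCherry e∈ | inj₂ p | inj₂ q with only-two len p q (λ eq → left≢right (cong proj₁ eq)) e∈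
  ...   | inj₁ refl = inj₂ (here refl)
  ...   | inj₂ refl = inj₂ (there (here refl))

  classify : ∀ {i j} → Joins (edges G) i j → Joins cherryEdges i j
  classify (inj₁ e∈) = toCherry e∈
  classify (inj₂ e∈) = Sum.swap (toCherry e∈)

-- Isomorphism with K₁,₂ ∪ (n-3) K₁

swap-left : ∀ {n} (i j : Fin n) → swap i j i ≡ j
swap-left i j rewrite dec-true (i ≟ᶠ i) refl = refl

swap-other : ∀ {n} (i j k : Fin n) → k ≢ i → k ≢ j → swap i j k ≡ k
swap-other i j k k≢i k≢j rewrite dec-false (k ≟ᶠ i) k≢i | dec-false (k ≟ᶠ j) k≢j = refl

module _ {m} {v a b : Fin (3 + m)} (v≢a : v ≢ a) (v≢b : v ≢ b) (a≢b : a ≢ b) where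

  private
    τ₁ τ₂ τ₃ : Permutation (3 + m) (3 + m)
    τ₁ = transpose v 0F
    τ₂ = transpose (τ₁ ⟨$⟩ʳ a) 1F
    τ₃ = transpose (τ₂ ⟨$⟩ʳ (τ₁ ⟨$⟩ʳ b)) 2F

    injective : ∀ (τ : Permutation (3 + m) (3 + m)) {i j} → i ≢ j → τ ⟨$⟩ʳ i ≢ τ ⟨$⟩ʳ j
    injective τ i≢j eq = i≢j (trans (sym (Inverse.strictlyInverseʳ τ _)) (trans (cong (Inverse.from τ) eq) (Inverse.strictlyInverseʳ τ _)))

    τ₁v : τ₁ ⟨$⟩ʳ v ≡ 0F
    τ₁v = swap-left v 0F

    τ₂0 : τ₂ ⟨$⟩ʳ 0F ≡ 0F
    τ₂0 = swap-other (τ₁ ⟨$⟩ʳ a) 1F 0F (λ eq → injective τ₁ v≢a (trans τ₁v eq)) (λ ())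

    τ₂a : τ₂ ⟨$⟩ʳ (τ₁ ⟨$⟩ʳ a) ≡ 1F
    τ₂a = swap-left (τ₁ ⟨$⟩ʳ a) 1F

    τ₃0 : τ₃ ⟨$⟩ʳ 0F ≡ 0F
    τ₃0 = swap-other (τ₂ ⟨$⟩ʳ (τ₁ ⟨$⟩ʳ b)) 2F 0F
      (λ eq → injective τ₂ (injective τ₁ v≢b) (trans (cong (τ₂ ⟨$⟩ʳ_) τ₁v) (trans τ₂0 eq))) (λ ())

    τ₃1 : τ₃ ⟨$⟩ʳ 1F ≡ 1F
    τ₃1 = swap-other (τ₂ ⟨$⟩ʳ (τ₁ ⟨$⟩ʳ b)) 2F 1F
      (λ eq → injective τ₂ (injective τ₁ a≢b) (trans τ₂a eq)) (λ ())

  -- Three transpositions put v, a, b in place one after another; by injectivity a later one does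
  -- not move the vertices already placed.
  align : ∃ λ (τ : Permutation (3 + m) (3 + m)) → τ ⟨$⟩ʳ v ≡ 0F × τ ⟨$⟩ʳ a ≡ 1F × τ ⟨$⟩ʳ b ≡ 2F
  align = τ₁ ∘ₚ τ₂ ∘ₚ τ₃
    , trans (cong (λ i → τ₃ ⟨$⟩ʳ (τ₂ ⟨$⟩ʳ i)) τ₁v) (trans (cong (τ₃ ⟨$⟩ʳ_) τ₂0) τ₃0)
    , trans (cong (τ₃ ⟨$⟩ʳ_) τ₂a) τ₃1
    , swap-left (τ₂ ⟨$⟩ʳ (τ₁ ⟨$⟩ʳ b)) 2F

module _ {m} (σ : Fin (3 + m) ↔ Fin (3 + m)) {v a b}
         (σv : Inverse.to σ v ≡ 0F) (σa : Inverse.to σ a ≡ 1F) (σb : Inverse.to σ b ≡ 2F) where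

  private
    open Inverse σ using (to; from; strictlyInverseʳ)

    reflect : ∀ {i j} → toℕ (to i) ≡ toℕ (to j) → i ≡ j
    reflect eq = trans (sym (strictlyInverseʳ _)) (trans (cong from (toℕ-injective eq)) (strictlyInverseʳ _))

    at : ∀ {i w k} → to w ≡ k → toℕ (to i) ≡ toℕ k → i ≡ w
    at σw eq = reflect (trans eq (cong toℕ (sym σw)))

  isEdgeℕ-joins : ∀ i j → T (isEdgeℕ (toℕ (to i)) (toℕ (to j))) ⇔ Joins ((v , a) ∷ (v , b) ∷ []) i j
  isEdgeℕ-joins i j = mk⇔ (forth _ _ refl refl) back
    where
    -- With p and q generalised, matching leaves just the four pairs on which `isEdgeℕ` is true.
    forth : ∀ p q → toℕ (to i) ≡ p → toℕ (to j) ≡ q → T (isEdgeℕ p q) → Joins ((v , a) ∷ (v , b) ∷ []) i j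
    forth 0 1 ip jq _ = inj₁ (here (cong₂ _,_ (at σv ip) (at σa jq)))
    forth 0 2 ip jq _ = inj₁ (there (here (cong₂ _,_ (at σv ip) (at σb jq))))
    forth 1 0 ip jq _ = inj₂ (here (cong₂ _,_ (at σv jq) (at σa ip)))
    forth 2 0 ip jq _ = inj₂ (there (here (cong₂ _,_ (at σv jq) (at σb ip))))
    back : Joins ((v , a) ∷ (v , b) ∷ []) i j → T (isEdgeℕ (toℕ (to i)) (toℕ (to j)))
    back (inj₁ (here refl))         rewrite σv | σa = tt
    back (inj₁ (there (here refl))) rewrite σv | σb = tt
    back (inj₂ (here refl))         rewrite σv | σa = tt
    back (inj₂ (there (here refl))) rewrite σv | σb = tt

bare⇒≃ : ∀ {m} {G : Graph (3 + m)} (C : Cherry G) → Bare C → G ≃ K12∪K1s (3 + m)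
bare⇒≃ C bare with align (Cherry.centre≢left C) (Cherry.centre≢right C) (Cherry.left≢right C)
... | σ , σv , σa , σb = σ , λ i j →
  T-antisym (Equivalence.from (isEdgeℕ-joins σ σv σa σb i j) ∘ Equivalence.to (bare i j))
            (Equivalence.from (bare i j) ∘ Equivalence.to (isEdgeℕ-joins σ σv σa σb i j))

≃⇒bare : ∀ {m} {G : Graph (3 + m)} → G ≃ K12∪K1s (3 + m) → Σ (Cherry G) Bare
≃⇒bare {m} {G} (σ , adj≡) = record
  { centre-left = from (bare v a) (inj₁ (here refl)) ; centre-right = from (bare v b) (inj₁ (there (here refl)))
  ; left≢right = λ eq → contradiction (trans (sym (inverseˡ′ 1F)) (trans (cong (Inverse.to σ) eq) (inverseˡ′ 2F))) λ () } , bare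
  where
  open Equivalence
  inverseˡ′ = Inverse.strictlyInverseˡ σ
  v = Inverse.from σ 0F
  a = Inverse.from σ 1F
  b = Inverse.from σ 2F
  bare : Represents ((v , a) ∷ (v , b) ∷ []) G
  bare i j rewrite adj≡ i j = isEdgeℕ-joins σ (inverseˡ′ 0F) (inverseˡ′ 1F) (inverseˡ′ 2F) i j

K12-bare : ∀ m → Σ (Cherry (K12∪K1s (3 + m))) Bare
K12-bare m = ≃⇒bare (↔-id _ , λ i j → refl)

-- Comparing averages

module _ {n} (G : Graph (suc n)) where

  private
    ∑≤≡sumFrom1 : ∀ m f → f 0 ≡ 0 → ∑≤ m f ≡ sumFrom1 m f
    ∑≤≡sumFrom1 zero    f f0 = f0
    ∑≤≡sumFrom1 (suc m) f f0 = cong (_+ f (suc m)) (∑≤≡sumFrom1 m f f0)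

    sumFrom1-cong : ∀ m {f g} → (∀ k → f k ≡ g k) → sumFrom1 m f ≡ sumFrom1 m g
    sumFrom1-cong zero    f≗g = refl
    sumFrom1-cong (suc m) f≗g = cong₂ _+_ (sumFrom1-cong m f≗g) (f≗g (suc m))

    ∑≤-*ˡ : ∀ m c f → ∑≤ m (λ k → c * f k) ≡ c * ∑≤ m f
    ∑≤-*ˡ zero    c f = refl
    ∑≤-*ˡ (suc m) c f = trans (cong (_+ c * f (suc m)) (∑≤-*ˡ m c f)) (sym (*-distribˡ-+ c (∑≤ m f) _))

    ∑≤-cong-≤ : ∀ m {f g} → (∀ k → k ≤ m → f k ≡ g k) → ∑≤ m f ≡ ∑≤ m g
    ∑≤-cong-≤ zero    f≗g = f≗g 0 z≤n
    ∑≤-cong-≤ (suc m) f≗g = cong₂ _+_ (∑≤-cong-≤ m (λ k k≤m → f≗g k (m≤n⇒m≤1+n k≤m))) (f≗g (suc m) ≤-refl)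

    𝕄-∑≤ : ∀ N m (F : ℕ → ℕ → ℕ) → 𝕄 N (λ x → ∑≤ m (λ k → F k x)) ≡ ∑≤ m (λ k → 𝕄 N (F k))
    𝕄-∑≤ N zero    F = refl
    𝕄-∑≤ N (suc m) F = trans (𝕄-+ N (λ x → ∑≤ m (λ k → F k x)) (F (suc m))) (cong (_+ 𝕄 N (F (suc m))) (𝕄-∑≤ N m F))

    𝓑≡ : ∑≤ (suc n) (properParts G) ≡ 𝓑 G
    𝓑≡ = trans (∑≤≡sumFrom1 (suc n) (properParts G) refl) (sumFrom1-cong (suc n) (λ k → sym (S≡properParts G k)))

    𝓣≡ : ∑≤ (suc n) (λ k → k * properParts G k) ≡ 𝓣 G
    𝓣≡ = trans (∑≤≡sumFrom1 (suc n) (λ k → k * properParts G k) refl)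
               (sumFrom1-cong (suc n) (λ k → cong (k *_) (sym (S≡properParts G k))))

  𝕄-chromatic : ∀ N → suc n ≤ N → 𝕄 N (chromatic G) ≡ N ! * 𝓑 G
  𝕄-chromatic N n≤N = begin
    𝕄 N (chromatic G)                                          ≡⟨ 𝕄-cong-≗ N (chromatic-↓ G) ⟩
    𝕄 N (λ x → ∑≤ (suc n) (λ k → x ↓ k * properParts G k))     ≡⟨ 𝕄-∑≤ N (suc n) _ ⟩
    ∑≤ (suc n) (λ k → 𝕄 N (λ x → x ↓ k * properParts G k))     ≡⟨ ∑≤-cong-≤ (suc n) (λ k k≤n →
      trans (𝕄-*ʳ N (properParts G k) (_↓ k)) (cong (_* properParts G k) (𝕄-↓ N k (≤-trans k≤n n≤N)))) ⟩
    ∑≤ (suc n) (λ k → N ! * properParts G k)                   ≡⟨ ∑≤-*ˡ (suc n) (N !) (properParts G) ⟩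
    N ! * ∑≤ (suc n) (properParts G)                           ≡⟨ cong (N ! *_) 𝓑≡ ⟩
    N ! * 𝓑 G                                                  ∎
    where open ≡-Reasoning

  𝕄-*chromatic : ∀ N → suc n < N → 𝕄 N (λ x → x * chromatic G x) ≡ N ! * (𝓑 G + 𝓣 G)
  𝕄-*chromatic N n<N = begin
    𝕄 N (λ x → x * chromatic G x)
      ≡⟨ 𝕄-cong-≗ N (λ x → trans (cong (x *_) (chromatic-↓ G x)) (sym (∑≤-*ˡ (suc n) x _))) ⟩
    𝕄 N (λ x → ∑≤ (suc n) (λ k → x * (x ↓ k * properParts G k)))
      ≡⟨ 𝕄-∑≤ N (suc n) (λ k x → x * (x ↓ k * properParts G k)) ⟩
    ∑≤ (suc n) (λ k → 𝕄 N (λ x → x * (x ↓ k * properParts G k)))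
      ≡⟨ ∑≤-cong-≤ (suc n) (λ k k≤n → trans (𝕄-cong-≗ N (λ x → sym (*-assoc x (x ↓ k) _)))
           (trans (𝕄-*ʳ N (properParts G k) (λ x → x * x ↓ k))
           (trans (cong (_* properParts G k) (𝕄-*↓ N k (≤-<-trans k≤n n<N))) (lem k (N !) (properParts G k))))) ⟩
    ∑≤ (suc n) (λ k → N ! * (properParts G k + k * properParts G k))
      ≡⟨ trans (∑≤-*ˡ (suc n) (N !) _) (cong (N ! *_) (∑≤-+ (suc n) (properParts G) (λ k → k * properParts G k))) ⟩
    N ! * (∑≤ (suc n) (properParts G) + ∑≤ (suc n) (λ k → k * properParts G k))
      ≡⟨ cong₂ (λ b t → N ! * (b + t)) 𝓑≡ 𝓣≡ ⟩
    N ! * (𝓑 G + 𝓣 G) ∎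
    where
    open ≡-Reasoning
    lem : ∀ k m p → suc k * m * p ≡ m * (p + k * p)
    lem = solve-∀

-- The quotient in `𝓐` with numerator and denominator as arguments, so that equations for `𝓣` and
-- `𝓑` can be substituted.
mean : ℕ → ℕ → ℚ
mean t zero    = 0ℚ
mean t (suc b) = (ℤ.+ t) / suc b

𝓐≡mean : ∀ {n} (G : Graph n) → 𝓐 G ≡ mean (𝓣 G) (𝓑 G)
𝓐≡mean G with 𝓑 G
... | zero  = refl
... | suc b = refl

mean-< : ∀ {t b t′ b′} → 0 < b → 0 < b′ → t * b′ < t′ * b → mean t b <ℚ mean t′ b′
mean-< {t} {suc b} {t′} {suc b′} _ _ tb′<t′b = ℚ.toℚᵘ-cancel-<
  (ℚᵘ.<-respˡ-≃ (ℚᵘ.≃-sym (ℚ.toℚᵘ-fromℚᵘ (ℚᵘ.mkℚᵘ (ℤ.+ t) b)))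
    (ℚᵘ.<-respʳ-≃ (ℚᵘ.≃-sym (ℚ.toℚᵘ-fromℚᵘ (ℚᵘ.mkℚᵘ (ℤ.+ t′) b′)))
      (ℚᵘ.*<* (subst₂ ℤ._<_ (pos-* t (suc b′)) (pos-* t′ (suc b)) (+<+ tb′<t′b)))))

bare-chromatic : ∀ {n} {G : Graph n} (C : Cherry G) → Bare C →
  ∀ z → chromatic G (2 + z) * (2 + z) ^ 2 ≡ (2 + z) ^ n * suc z ^ 2
bare-chromatic {n} {G} C bare z with factorise 2 (Cherry.cherryEdges C) ≤-refl (Cherry.simple C) (Cherry.deg≤2 C)
... | p , js , size , eq = begin
  chromatic G (2 + z) * (2 + z) ^ 2                        ≡⟨ cong (_* (2 + z) ^ 2) (chromatic≡edgeCount {E = Cherry.cherryEdges C} {G} bare (2 + z)) ⟩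
  edgeCount (Cherry.cherryEdges C) (2 + z) * (2 + z) ^ 2   ≡⟨ eq z ⟩
  (2 + z) ^ n * factored p js (2 + z)                      ≡⟨ cong ((2 + z) ^ n *_) (two-paths p js size) ⟩
  (2 + z) ^ n * suc z ^ 2                                  ∎
  where
  open ≡-Reasoning
  -- Two edges leave no room for a cycle, which has at least three.
  two-paths : ∀ p js → 2 ≡ factoredSize p js → factored p js (2 + z) ≡ suc z ^ 2
  two-paths (suc (suc zero)) []       _    = *-identityʳ _
  two-paths p                (j ∷ js) size = contradiction
    (≤-trans (≤-trans (s≤s (s≤s (s≤s z≤n))) (m≤n+m (cyclesSize (j ∷ js)) p)) (≤-reflexive (sym size))) λ { (s≤s (s≤s ())) }

-- h stands for the chromatic polynomial x^(n-2) (x-1)^2 of K₁,₂ ∪ (n-3) K₁.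
module Comparison {n : ℕ} (f h : ℕ → ℕ) (f-zero : ∀ {x} → x < 2 → f x ≡ 0)
  (p : ℕ) (js : List ℕ)
  (f-≡ : ∀ z → f (2 + z) * (2 + z) ^ factoredSize p js ≡ (2 + z) ^ n * factored p js (2 + z))
  (h-≡ : ∀ z → h (2 + z) * (2 + z) ^ 2 ≡ (2 + z) ^ n * suc z ^ 2) where

  private
    e = factoredSize p js

    h-pos : ∀ z → 0 < h (2 + z)
    h-pos z = n≢0⇒n>0 λ h≡0 → <⇒≢ (*-mono-< (m^n>0 (2 + z) n) (m^n>0 (suc z) 2))
      (trans (cong (_* (2 + z) ^ 2) (sym h≡0)) (h-≡ z))

    -- `M` clears the denominators of f and h at both arguments at once; what remains is the
    -- inequality of the model functions times the common factor `K`.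
    K M : ℕ → ℕ
    K z = (2 + z) ^ n * (3 + z) ^ n
    M z = (2 + z) ^ e * (3 + z) ^ 2 * ((2 + z) ^ 2 * (3 + z) ^ e)

    M-pos : ∀ z → 0 < M z
    M-pos z = *-mono-< (*-mono-< (m^n>0 (2 + z) e) (m^n>0 (3 + z) 2)) (*-mono-< (m^n>0 (2 + z) 2) (m^n>0 (3 + z) e))

    model-h model-f : ℕ → ℕ
    model-h = power e ⊗ pathPoly 2
    model-f = power 2 ⊗ factored p js

    lower : ∀ z → f (2 + z) * h (3 + z) * M z ≡ K z * (model-f (2 + z) * model-h (3 + z))
    lower z = trans (lem (f (2 + z)) (h (3 + z)) ((2 + z) ^ e) ((3 + z) ^ 2) ((2 + z) ^ 2) ((3 + z) ^ e))
      (trans (cong₂ (λ a b → a * b * ((2 + z) ^ 2 * (3 + z) ^ e)) (f-≡ z) (h-≡ (suc z)))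
             (lem₂ ((2 + z) ^ n) (factored p js (2 + z)) ((3 + z) ^ n) ((2 + z) ^ 2) ((2 + z) ^ 2) ((3 + z) ^ e)))
      where
      lem : ∀ f h a b c d → f * h * (a * b * (c * d)) ≡ f * a * (h * b) * (c * d)
      lem = solve-∀
      lem₂ : ∀ x q y r s t → x * q * (y * r) * (s * t) ≡ x * y * (s * q * (t * r))
      lem₂ = solve-∀

    upper : ∀ z → f (3 + z) * h (2 + z) * M z ≡ K z * (model-f (3 + z) * model-h (2 + z))
    upper z = trans (lem (f (3 + z)) (h (2 + z)) ((2 + z) ^ e) ((3 + z) ^ 2) ((2 + z) ^ 2) ((3 + z) ^ e))
      (trans (cong₂ (λ a b → a * b * ((2 + z) ^ e * (3 + z) ^ 2)) (f-≡ (suc z)) (h-≡ z))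
             (lem₂ ((2 + z) ^ n) (factored p js (3 + z)) ((3 + z) ^ n) (suc z ^ 2) ((2 + z) ^ e) ((3 + z) ^ 2)))
      where
      lem : ∀ f h a b c d → f * h * (a * b * (c * d)) ≡ f * d * (h * c) * (a * b)
      lem = solve-∀
      lem₂ : ∀ x q y r s t → y * q * (x * r) * (s * t) ≡ x * y * (t * q * (s * r))
      lem₂ = solve-∀

    consecutive : 2 ≤ e → ∀ z → RatioUp h f z
    consecutive 2≤e z = *-cancelʳ-≤ _ _ (M z) {{>-nonZero (M-pos z)}} (begin
      f (2 + z) * h (3 + z) * M z                     ≡⟨ lower z ⟩
      K z * (model-f (2 + z) * model-h (3 + z))       ≤⟨ *-monoʳ-≤ (K z) (factored-up p js z 2≤e) ⟩
      K z * (model-f (3 + z) * model-h (2 + z))       ≡⟨ upper z ⟨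
      f (3 + z) * h (2 + z) * M z                     ∎)
      where open ≤-Reasoning

  consecutive< : 3 ≤ e → ∀ z → RatioUp< h f (suc z)
  consecutive< 3≤e z = *-cancelʳ-< (M (suc z)) _ _ (begin-strict
    f (3 + z) * h (4 + z) * M (suc z)                     ≡⟨ lower (suc z) ⟩
    K (suc z) * (model-f (3 + z) * model-h (4 + z))       <⟨ *-monoʳ-< (K (suc z)) {{>-nonZero K-pos}} (factored-up< p js z 3≤e) ⟩
    K (suc z) * (model-f (4 + z) * model-h (3 + z))       ≡⟨ upper (suc z) ⟨
    f (4 + z) * h (3 + z) * M (suc z)                     ∎)
    where
    open ≤-Reasoning
    K-pos : 0 < K (suc z)
    K-pos = *-mono-< (m^n>0 (3 + z) n) (m^n>0 (4 + z) n)

  -- Consecutive inequalities are chained by cancelling the positive intermediate value of h; for x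
  -- < 2 the left side is 0.
  ratio : 2 ≤ e → ∀ {x y} → x < y → f x * h y ≤ f y * h x
  ratio 2≤e {zero} _ rewrite f-zero {0} (s≤s z≤n) = z≤n
  ratio 2≤e {suc zero} _ rewrite f-zero {1} (s≤s (s≤s z≤n)) = z≤n
  ratio 2≤e {suc (suc z)} x<y with m≤n⇒∃[o]m+o≡n x<y
  ... | d , refl = chain d
    where
    chain : ∀ d → f (2 + z) * h (3 + z + d) ≤ f (3 + z + d) * h (2 + z)
    chain zero rewrite +-identityʳ z = consecutive 2≤e z
    chain (suc d) rewrite +-suc z d = *-cancelʳ-≤ _ _ (h (3 + z + d)) {{>-nonZero (h-pos (suc (z + d)))}} (begin
      f (2 + z) * h (4 + z + d) * h (3 + z + d)   ≡⟨ lem (f (2 + z)) _ _ ⟩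
      f (2 + z) * h (3 + z + d) * h (4 + z + d)   ≤⟨ *-monoˡ-≤ (h (4 + z + d)) (chain d) ⟩
      f (3 + z + d) * h (2 + z) * h (4 + z + d)   ≡⟨ lem (f (3 + z + d)) _ _ ⟩
      f (3 + z + d) * h (4 + z + d) * h (2 + z)   ≤⟨ *-monoˡ-≤ (h (2 + z)) (consecutive 2≤e (suc (z + d))) ⟩
      f (4 + z + d) * h (3 + z + d) * h (2 + z)   ≡⟨ lem (f (4 + z + d)) (h (3 + z + d)) _ ⟩
      f (4 + z + d) * h (2 + z) * h (3 + z + d)   ∎)
      where
      open ≤-Reasoning
      lem : ∀ a b c → a * b * c ≡ a * c * b
      lem = solve-∀

degree≤maxDegree : ∀ {n} (G : Graph n) v → degree G v ≤ maxDegree G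
degree≤maxDegree {n} G v = ⊔-upper (degree G) (allFin n) (∈-allFin v)

module _ {n N} (n<N : suc n < N) {G H : Graph (suc n)} (D : Cherry H) (D-bare : Bare D) where

  -- Both graphs have the same chromatic polynomial, hence the same moments, and these determine `𝓑`
  -- and `𝓣`. This replaces transporting colourings along an isomorphism.
  bare⇒𝓐≡ : (C : Cherry G) → Bare C → 𝓐 G ≡ 𝓐 H
  bare⇒𝓐≡ C bare = trans (𝓐≡mean G) (trans (cong₂ mean 𝓣≡ 𝓑≡) (sym (𝓐≡mean H)))
    where
    chromatic≡ : ∀ x → chromatic G x ≡ chromatic H x
    chromatic≡ zero = trans (chromatic-zero G (Cherry.centre-left C) (s≤s z≤n))
                            (sym (chromatic-zero H (Cherry.centre-left D) (s≤s z≤n)))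
    chromatic≡ (suc zero) = trans (chromatic-zero G (Cherry.centre-left C) (s≤s (s≤s z≤n)))
                                  (sym (chromatic-zero H (Cherry.centre-left D) (s≤s (s≤s z≤n))))
    chromatic≡ (suc (suc z)) = *-cancelʳ-≡ _ _ ((2 + z) ^ 2) (trans (bare-chromatic C bare z) (sym (bare-chromatic D D-bare z)))

    𝓑≡ : 𝓑 G ≡ 𝓑 H
    𝓑≡ = *-cancelˡ-≡ _ _ (N !) {{N !≢0}} (trans (sym (𝕄-chromatic G N (<⇒≤ n<N)))
      (trans (𝕄-cong-≗ N chromatic≡) (𝕄-chromatic H N (<⇒≤ n<N))))

    𝓣≡ : 𝓣 G ≡ 𝓣 H
    𝓣≡ = +-cancelˡ-≡ (𝓑 G) _ _ (*-cancelˡ-≡ _ _ (N !) {{N !≢0}} (trans (sym (𝕄-*chromatic G N n<N))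
      (trans (𝕄-cong-≗ N (λ x → cong (x *_) (chromatic≡ x))) (trans (𝕄-*chromatic H N n<N) (cong (λ b → N ! * (b + 𝓣 H)) (sym 𝓑≡))))))

  𝓐-< : 6 ≤ N → maxDegree G ≡ 2 → Cherry G → 3 ≤ length (edges G) → 𝓐 H <ℚ 𝓐 G
  𝓐-< 6≤N Δ≡2 C 3≤len with factorise (length (edges G)) (edges G) ≤-refl (edges-simple G)
                         (λ w → ≤-trans (deg-edges G w) (≤-trans (degree≤maxDegree G w) (≤-reflexive Δ≡2)))
  ... | p , js , size , eq = subst₂ _<ℚ_ (sym (𝓐≡mean H)) (sym (𝓐≡mean G)) (mean-< 𝓑H-pos 𝓑G-pos 𝓣𝓑<)
    where
    f = chromatic G
    h = chromatic H
    f-≡ : ∀ z → f (2 + z) * (2 + z) ^ factoredSize p js ≡ (2 + z) ^ (suc n) * factored p js (2 + z)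
    f-≡ z = trans (cong₂ (λ a l → a * (2 + z) ^ l) (chromatic≡edgeCount {E = edges G} {G} (edges-represent G) (2 + z)) (sym size)) (eq z)
    3≤e : 3 ≤ factoredSize p js
    3≤e = ≤-trans 3≤len (≤-reflexive size)
    open Comparison {suc n} f h (chromatic-zero G (Cherry.centre-left C)) p js f-≡ (bare-chromatic D D-bare)

    product< : (N ! * (𝓑 H + 𝓣 H)) * (N ! * 𝓑 G) < (N ! * (𝓑 G + 𝓣 G)) * (N ! * 𝓑 H)
    product< = subst₂ _<_
      (cong₂ _*_ (𝕄-*chromatic H N n<N) (𝕄-chromatic G N (<⇒≤ n<N)))
      (cong₂ _*_ (𝕄-*chromatic G N n<N) (𝕄-chromatic H N (<⇒≤ n<N)))
      -- The strict pair is x = 3, y = 4, so the required bound y + 2 ≤ N is `6≤N`.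
      (chebyshev-< N {f} {h} (ratio (≤-trans (n≤1+n 2) 3≤e)) 3 0 6≤N (consecutive< 3≤e 0))

    𝓣𝓑< : 𝓣 H * 𝓑 G < 𝓣 G * 𝓑 H
    -- The moments carry `𝓑` + `𝓣` instead of `𝓣`; the surplus `𝓑 H * 𝓑 G` is the same on both sides
    -- and cancels.
    𝓣𝓑< = +-cancelˡ-< (𝓑 H * 𝓑 G) _ _ (*-cancelˡ-< (N ! * N !) _ _
      (subst₂ _<_ (lem (N !) (𝓑 H) (𝓣 H) (𝓑 G)) (lem₂ (N !) (𝓑 G) (𝓣 G) (𝓑 H)) product<))
      where
      lem : ∀ n b t c → n * (b + t) * (n * c) ≡ n * n * (b * c + t * c)
      lem = solve-∀
      lem₂ : ∀ n c t b → n * (c + t) * (n * b) ≡ n * n * (b * c + t * b)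
      lem₂ = solve-∀

    𝓑H-pos : 0 < 𝓑 H
    𝓑H-pos = n≢0⇒n>0 λ eq → contradiction (subst (λ b → 𝓣 H * 𝓑 G < b) (trans (cong (𝓣 G *_) eq) (*-zeroʳ (𝓣 G))) 𝓣𝓑<) λ ()

    𝓑G-pos : 0 < 𝓑 G
    𝓑G-pos = n≢0⇒n>0 λ eq → <⇒≢
      -- f 4 is positive, as a factor of the larger side of a strict inequality.
      (𝕄-pos N 4 {f} 6≤N (n≢0⇒n>0 λ f4≡0 → contradiction
        (subst (λ a → f 3 * h 4 < a * h 3) f4≡0 (consecutive< 3≤e 0)) λ ()))
      (sym (trans (𝕄-chromatic G N (<⇒≤ n<N)) (trans (cong (N ! *_) eq) (*-zeroʳ (N !)))))

fromCherry : ∀ {n} (G : Graph n) → maxDegree G ≡ 2 → Cherry G → 3 ≤ n →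
  (𝓐 (K12∪K1s n) ≤ℚ 𝓐 G) × ((𝓐 G ≡ 𝓐 (K12∪K1s n)) ⇔ (G ≃ K12∪K1s n))
fromCherry {suc (suc (suc m))} G Δ≡2 C (s≤s (s≤s (s≤s z≤n))) = byEdges (length (edges G) ≤? 2)
  where
  H = K12∪K1s (3 + m)
  D = K12-bare m
  -- The choice N = n + 3 with n = 3 + m: it exceeds n and is at least 6 for every m.
  3+m<6+m : 3 + m < 6 + m
  3+m<6+m = m≤n+m (4 + m) 2

  ≃⇒𝓐≡ : G ≃ H → 𝓐 G ≡ 𝓐 H
  ≃⇒𝓐≡ G≃H with ≃⇒bare G≃H
  ... | C′ , bare = bare⇒𝓐≡ 3+m<6+m (proj₁ D) (proj₂ D) C′ bare

  byEdges : Dec (length (edges G) ≤ 2) → (𝓐 H ≤ℚ 𝓐 G) × ((𝓐 G ≡ 𝓐 H) ⇔ (G ≃ H))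
  byEdges (yes len) = ℚ.≤-reflexive (sym (≃⇒𝓐≡ iso)) , mk⇔ (λ _ → iso) ≃⇒𝓐≡
    where iso = bare⇒≃ C (two-edges-bare C len)
  byEdges (no len) = ℚ.<⇒≤ strict , mk⇔ (λ eq → contradiction (sym eq) (ℚ.<⇒≢ strict)) ≃⇒𝓐≡
    where strict = 𝓐-< 3+m<6+m (proj₁ D) (proj₂ D) (m≤m+n 6 m) Δ≡2 C (≰⇒> len)

theorem27 : (n : ℕ) (G : Graph n) → maxDegree G ≡ 2 →
    (𝓐 (K12∪K1s n) ≤ℚ 𝓐 G) × ((𝓐 G ≡ 𝓐 (K12∪K1s n)) ⇔ (G ≃ K12∪K1s n))
theorem27 n G Δ≡2 = fromCherry G Δ≡2 C (Cherry.3≤n C)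
  where
  C = maxDegree-cherry G Δ≡2
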